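{- The collection $\{1324, 231\}$ is inversion monotone; that is, for all integers $n, k \ge 0$, the number of permutations of length $n$ with exactly $k$ inversions that avoid both $1324$ and $231$ is at most the number of permutations of length $n+1$ with exactly $k$ inversions that avoid both $1324$ and $231$.
   Context: A permutation $\pi\in S_n$ contains a pattern $p \in S_m$ if $\pi$ (in one-line notation) has a subsequence order-isomorphic to $p$; otherwise $\pi$ avoids $p$. An inversion of $\pi$ is a pair $i<j$ with $\pi_i>\pi_j$. For a set $B$ of patterns, $\mathrm{av}_n^k(B)$ is the number of permutations in $S_n$ with exactly $k$ inversions that avoid every pattern in $B$. $B$ is called inversion monotone if $\mathrm{av}_n^k(B)\le \mathrm{av}_{n+1}^k(B)$ for all $n$ and $k$. -}

module Defs where

open import Data.Fin.Base using (Fin; zero; suc; _<_; punchIn)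
open import Data.Fin.Patterns using (0F; 1F; 2F; 3F)
open import Data.Fin.Permutation as P
  using (Permutation′; permutation; _⟨$⟩ʳ_; _≈_; insert; remove)
open import Data.Fin.Properties using (_<?_; all?; any?; punchIn-injective)
open import Data.List.Base
  using (List; []; _∷_; length; filter; allFin; cartesianProduct; cartesianProductWith)
open import Data.List.Membership.Propositional.Properties using (∈-allFin)
import Data.List.Membership.Setoid as SetoidMembership
import Data.List.Membership.Setoid.Properties as SetoidMembershipₚ
open import Data.List.Relation.Unary.All as All using (All; []; _∷_)
open import Data.List.Relation.Unary.AllPairs using ([]; _∷_)
open import Data.List.Relation.Unary.Any using (here)
import Data.List.Relation.Unary.Unique.Setoid as SetoidUnique
import Data.List.Relation.Unary.Unique.Setoid.Properties as SetoidUniqueₚ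
open import Data.List.Relation.Unary.Unique.Propositional.Properties using (allFin⁺)
open import Data.Nat.Base using (ℕ; zero; suc; _≤_)
open import Data.Nat.Properties using (_≟_)
open import Data.Product.Base using (∃; ∃-syntax; _×_; _,_; uncurry)
open import Data.Vec.Functional as Vector using (Vector)
open import Function.Base using (_∘_)
open import Function.Bundles using (_⇔_; mk⇔; module Equivalence)
open import Level using (0ℓ)
open import Relation.Binary.Bundles using (Setoid)
open import Relation.Binary.PropositionalEquality
  using (_≡_; refl; sym; trans; cong; subst₂; _≗_; setoid)
open import Relation.Nullary using (¬_; Dec)
open import Relation.Nullary.Decidable using (map′; ¬?; _×-dec_; _→-dec_)
open import Relation.Unary using (Pred; Decidable)

-- Positions and values of a permutation of length n are 0, …, n-1, so a
-- permutation written 1-based in one-line notation has its entries shifted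
-- down by one.

Inversion : ∀ {n} → Permutation′ n → Pred (Fin n × Fin n) 0ℓ
Inversion π (i , j) = i < j × π ⟨$⟩ʳ j < π ⟨$⟩ʳ i

inversion? : ∀ {n} (π : Permutation′ n) → Decidable (Inversion π)
inversion? π (i , j) = i <? j ×-dec π ⟨$⟩ʳ j <? π ⟨$⟩ʳ i

inv : ∀ {n} → Permutation′ n → ℕ
inv {n} π = length (filter (inversion? π) (cartesianProduct (allFin n) (allFin n)))

-- f lists the positions of a subsequence of length m.

Increasing : ∀ {m n} → (Fin m → Fin n) → Set
Increasing f = ∀ i j → i < j → f i < f j

OrderIsomorphicAt : ∀ {m n} → Permutation′ m → Permutation′ n → (Fin m → Fin n) → Set
OrderIsomorphicAt p π f =
  ∀ i j → p ⟨$⟩ʳ i < p ⟨$⟩ʳ j ⇔ π ⟨$⟩ʳ f i < π ⟨$⟩ʳ f j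

Contains : ∀ {m n} → Permutation′ m → Permutation′ n → Set
Contains {m} {n} p π =
  ∃[ f ] Increasing {m} {n} f × OrderIsomorphicAt p π f

Avoids : ∀ {m n} → Permutation′ m → Permutation′ n → Set
Avoids p π = ¬ Contains p π

Pattern : Set
Pattern = ∃ Permutation′

AvoidsAll : ∀ {n} → List Pattern → Permutation′ n → Set
AvoidsAll B π = All (λ (_ , p) → Avoids p π) B

-- An existential over functions Fin m → Fin n is decided by exhaustive search;
-- without function extensionality the predicate must respect _≗_.

anyVector? : ∀ {m n} {P : Pred (Vector (Fin n) m) 0ℓ} →
             (∀ {f g} → f ≗ g → P f → P g) → Decidable P → Dec (∃ P)
anyVector? {zero} resp P? =
  map′ (Vector.[] ,_) (λ (f , Pf) → resp (λ ()) Pf) (P? Vector.[])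
anyVector? {suc m} {P = P} resp P? =
  map′ (λ (x , f , Pxf) → (x Vector.∷ f) , Pxf)
       (λ (f , Pf) → f zero , (f ∘ suc) , resp (η f) Pf)
       (any? λ x → anyVector? (λ f≗g → resp (∷-cong x f≗g)) (λ f → P? (x Vector.∷ f)))
  where
  η : ∀ f → f ≗ (f zero Vector.∷ (f ∘ suc))
  η f zero    = refl
  η f (suc i) = refl

  ∷-cong : ∀ x {f g : Vector _ m} → f ≗ g → (x Vector.∷ f) ≗ (x Vector.∷ g)
  ∷-cong x f≗g zero    = refl
  ∷-cong x f≗g (suc i) = f≗g i

infix 3 _⇔-dec_

_⇔-dec_ : ∀ {A B : Set} → Dec A → Dec B → Dec (A ⇔ B)
a? ⇔-dec b? =
  map′ (uncurry mk⇔) (λ e → Equivalence.to e , Equivalence.from e)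
       ((a? →-dec b?) ×-dec (b? →-dec a?))

contains? : ∀ {m n} (p : Permutation′ m) (π : Permutation′ n) → Dec (Contains p π)
contains? p π = anyVector? resp λ f →
  (all? λ i → all? λ j → i <? j →-dec f i <? f j)
  ×-dec
  (all? λ i → all? λ j → p ⟨$⟩ʳ i <? p ⟨$⟩ʳ j ⇔-dec π ⟨$⟩ʳ f i <? π ⟨$⟩ʳ f j)
  where
  resp : ∀ {f g} → f ≗ g → Increasing f × OrderIsomorphicAt p π f →
                           Increasing g × OrderIsomorphicAt p π g
  resp f≗g (inc , iso) =
    (λ i j i<j → subst₂ _<_ (f≗g i) (f≗g j) (inc i j i<j)) ,
    (λ i j → subst₂ (λ x y → _ ⇔ π ⟨$⟩ʳ x < π ⟨$⟩ʳ y) (f≗g i) (f≗g j) (iso i j))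

avoidsAll? : ∀ {n} (B : List Pattern) → Decidable (AvoidsAll {n} B)
avoidsAll? B π = All.all? (λ (_ , p) → ¬? (contains? p π)) B

-- The first entry j is arbitrary and the remaining entries, standardised, are
-- an arbitrary shorter permutation. `allPermutations-complete` and
-- `allPermutations-unique` show that each permutation is listed exactly once,
-- where permutations are compared by _≈_, i.e. by their one-line notation.

allPermutations : ∀ n → List (Permutation′ n)
allPermutations zero    = P.id ∷ []
allPermutations (suc n) =
  cartesianProductWith (insert zero) (allFin (suc n)) (allPermutations n)

≈-setoid : ℕ → Setoid 0ℓ 0ℓ
≈-setoid n = record
  { Carrier       = Permutation′ n
  ; _≈_           = _≈_
  ; isEquivalence = record
    { refl  = λ _ → refl
    ; sym   = λ π≈ρ i → sym (π≈ρ i)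
    ; trans = λ π≈ρ ρ≈σ i → trans (π≈ρ i) (ρ≈σ i)
    }
  }

insert-cong : ∀ {n} {j k} {π ρ : Permutation′ n} → j ≡ k → π ≈ ρ →
              insert zero j π ≈ insert zero k ρ
insert-cong refl π≈ρ zero    = refl
insert-cong {j = j} refl π≈ρ (suc i) = cong (punchIn j) (π≈ρ i)

insert-injective : ∀ {n} {j k} {π ρ : Permutation′ n} →
                   insert zero j π ≈ insert zero k ρ → j ≡ k × π ≈ ρ
insert-injective {j = j} eq with refl ← eq zero =
  refl , λ i → punchIn-injective j _ _ (eq (suc i))

allPermutations-complete : ∀ {n} (π : Permutation′ n) →
  let open SetoidMembership (≈-setoid n) in π ∈ allPermutations n
allPermutations-complete {zero}  π = here λ ()
allPermutations-complete {suc n} π =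
  SetoidMembershipₚ.∈-resp-≈ (≈-setoid (suc n))
    {x = insert zero (π ⟨$⟩ʳ zero) (remove zero π)} {y = π}
    (P.insert-remove zero π)
    (SetoidMembershipₚ.∈-cartesianProductWith⁺
      (setoid (Fin (suc n))) (≈-setoid n) (≈-setoid (suc n))
      {f = insert zero}
      (λ {j} {k} {π} {ρ} → insert-cong {j = j} {k} {π} {ρ})
      (∈-allFin (π ⟨$⟩ʳ zero))
      (allPermutations-complete (remove zero π)))

allPermutations-unique : ∀ n → SetoidUnique.Unique (≈-setoid n) (allPermutations n)
allPermutations-unique zero    = [] ∷ []
allPermutations-unique (suc n) =
  SetoidUniqueₚ.cartesianProductWith⁺
    (setoid (Fin (suc n))) (≈-setoid n) (≈-setoid (suc n))
    (insert zero)
    (λ {j} {k} {π} {ρ} → insert-injective {j = j} {k} {π} {ρ})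
    (allFin⁺ (suc n)) (allPermutations-unique n)

av : (n k : ℕ) → List Pattern → ℕ
av n k B =
  length (filter (λ π → inv π ≟ k ×-dec avoidsAll? B π) (allPermutations n))

InversionMonotone : List Pattern → Set
InversionMonotone B = ∀ n k → av n k B ≤ av (suc n) k B

p1324 : Permutation′ 4
p1324 = permutation to to involutive involutive
  where
  to : Fin 4 → Fin 4
  to 0F = 0F
  to 1F = 2F
  to 2F = 1F
  to 3F = 3F

  involutive : ∀ i → to (to i) ≡ i
  involutive 0F = refl
  involutive 1F = refl
  involutive 2F = refl
  involutive 3F = refl

p231 : Permutation′ 3
p231 = permutation to from to-from from-to
  where
  to : Fin 3 → Fin 3
  to 0F = 1F
  to 1F = 2F
  to 2F = 0F

  from : Fin 3 → Fin 3
  from 0F = 2F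
  from 1F = 0F
  from 2F = 1F

  to-from : ∀ i → to (from i) ≡ i
  to-from 0F = refl
  to-from 1F = refl
  to-from 2F = refl

  from-to : ∀ i → from (to i) ≡ i
  from-to 0F = refl
  from-to 1F = refl
  from-to 2F = refl

{-# OPTIONS --safe #-}

-- Let D_a = ∏_{0<i<a} (1 + qⁱ).  A permutation avoiding 231 has the form j L R
-- with L < j < R.  If R is empty, then j is maximal and L is an arbitrary
-- avoider of {1324, 231}.  Otherwise R can play the 4 and j the 1 of a 1324, so
-- L avoids {132, 231} and R avoids {213, 231}; in L the maximum comes first or
-- last, and in R the first entry is the minimum or the maximum, so both classes
-- have inversion generating functions D_a and D_b.  Hence the generating
-- function A_n of the avoiders satisfies A_{m+1} = U_m + qᵐ A_m with
-- U_m = Σ_{a+b=m, b>0} qᵃ D_a D_b.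
--
-- For coefficientwise inequalities everything rests on qⁱ D_a ≤ D_{a+1} for
-- i ≤ a.  It gives q^{m+1} U_m + U_{m+1} ≤ U_{m+2} and, by induction,
-- qⁱ A_m ≤ A_{m+2} for i ≤ m.  Expanding A_{m+3} twice and using
-- q^{m+2} q^{m+1} A_{m+1} = q^{m+3} (qᵐ A_{m+1}) ≤ q^{m+3} A_{m+3} then yields
-- A_{m+3} ≤ A_{m+4}.

module Submission where

open import Defs using (InversionMonotone; p1324; p231)
open import Data.List.Base using ([]; _∷_)
open import Data.Product.Base using (_,_)

open import Defs using
  ( inv; inversion?; Contains; OrderIsomorphicAt; Pattern; AvoidsAll; avoidsAll?
  ; allPermutations; allPermutations-complete; allPermutations-unique )
open import Data.Bool.Base using (true; false)
open import Data.Fin.Base as Fin using (Fin; zero; suc; fromℕ<; toℕ)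
open import Data.Fin.Patterns using (0F; 1F; 2F; 3F)
open import Data.Fin.Permutation as P using (Permutation′; permutation; _⟨$⟩ʳ_; _⟨$⟩ˡ_; _≈_)
open import Data.Fin.Properties as Finₚ
  using (toℕ<n; toℕ-injective; toℕ-fromℕ<; fromℕ<-injective; injective⇒≤)
open import Data.List.Base
  using ( List; [_]; _++_; map; length; filter; lookup; tabulate; allFin
        ; cartesianProduct; cartesianProductWith )
  renaming (_∷ʳ_ to infixl 6 _▷_)
open import Data.List.Membership.Propositional using (_∈_; find)
open import Data.List.Membership.Propositional.Properties
open import Data.List.Membership.Propositional.Properties.WithK using (unique∧set⇒bag)
open import Data.List.Properties
open import Data.List.Relation.Binary.BagAndSetEquality using (∼bag⇒↭)
open import Data.List.Relation.Binary.Permutation.Propositional.Properties using (↭-length)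
open import Data.List.Relation.Binary.Sublist.Propositional
  using (_⊆_; []; _∷_; _∷ʳ_; ⊆-trans; ⊆-refl; minimum; to∈; from∈)
open import Data.List.Relation.Binary.Sublist.Propositional.Properties
  using (All-resp-⊆; ++⁺; ++⁺ˡ; ++⁺ʳ; map⁺)
open import Data.List.Relation.Unary.All as All using (All; []; _∷_)
import Data.List.Relation.Unary.All.Properties as Allₚ
open import Data.List.Relation.Unary.AllPairs as AllPairs using (AllPairs; []; _∷_)
import Data.List.Relation.Unary.AllPairs.Properties as AllPairsₚ
open import Data.List.Relation.Unary.Any as Any using (here; there)
open import Data.List.Relation.Unary.Any.Properties using (lookup-index)
open import Data.List.Relation.Unary.Unique.Propositional using (Unique)
import Data.List.Relation.Unary.Unique.Propositional.Properties as Uniqueₚ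
open import Data.Nat.Base
open import Data.Nat.Induction using (<-rec)
open import Data.Nat.Properties
open import Data.List.Membership.DecPropositional _≟_ using (_∈?_)
open import Data.Nat.Tactic.RingSolver using (solve-∀)
open import Data.Product.Base using (_×_; ∃-syntax; ∃₂; proj₁; proj₂)
open import Data.Sum.Base using (_⊎_; inj₁; inj₂; [_,_]′)
open import Function.Base using (_∘_; id)
open import Function.Bundles using (mk⇔; module Equivalence)
open import Level using (0ℓ)
open import Relation.Binary.Bundles using (Preorder)
open import Relation.Binary.Definitions using (tri<; tri≈; tri>)
open import Relation.Binary.PropositionalEquality
  using (_≡_; _≢_; refl; sym; trans; cong; cong₂; subst; subst₂; _≗_; module ≡-Reasoning)
import Relation.Binary.Reasoning.Preorder as PreorderReasoning
open import Relation.Nullary using (¬_; yes; no; contradiction)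
open import Relation.Nullary.Decidable using (_×-dec_)
open import Relation.Unary using (Pred; Decidable; _≐_)

-- Polynomials with natural coefficients, ordered coefficientwise.

-- A polynomial in q is its sequence of coefficients.

Poly : Set
Poly = ℕ → ℕ

infix  4 _≼_
infixl 6 _⊕_

_≼_ : Poly → Poly → Set
P ≼ Q = ∀ k → P k ≤ Q k

𝟘 𝟙 : Poly
𝟘 _ = 0
𝟙 zero    = 1
𝟙 (suc _) = 0

_⊕_ : Poly → Poly → Poly
(P ⊕ Q) k = P k + Q k

q : Poly → Poly
q P zero    = 0
q P (suc k) = P k

q^ : ℕ → Poly → Poly
q^ zero    P = P
q^ (suc i) P = q (q^ i P)

≼-preorder : Preorder 0ℓ 0ℓ 0ℓ
≼-preorder = record
  { Carrier    = Poly
  ; _≈_        = _≗_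
  ; _≲_        = _≼_
  ; isPreorder = record
    { isEquivalence = record
      { refl  = λ _ → refl
      ; sym   = λ e k → sym (e k)
      ; trans = λ e f k → trans (e k) (f k)
      }
    ; reflexive = λ e k → ≤-reflexive (e k)
    ; trans     = λ e f k → ≤-trans (e k) (f k)
    }
  }

module ≼-Reasoning = PreorderReasoning ≼-preorder

≼-refl : ∀ {P} → P ≼ P
≼-refl _ = ≤-refl

≼-trans : ∀ {P Q R} → P ≼ Q → Q ≼ R → P ≼ R
≼-trans P≼Q Q≼R k = ≤-trans (P≼Q k) (Q≼R k)

⊕-mono : ∀ {P P′ Q Q′} → P ≼ P′ → Q ≼ Q′ → P ⊕ Q ≼ P′ ⊕ Q′
⊕-mono P≼P′ Q≼Q′ k = +-mono-≤ (P≼P′ k) (Q≼Q′ k)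

⊕-cong : ∀ {P P′ Q Q′ : Poly} → P ≗ P′ → Q ≗ Q′ → P ⊕ Q ≗ P′ ⊕ Q′
⊕-cong P≗P′ Q≗Q′ k = cong₂ _+_ (P≗P′ k) (Q≗Q′ k)

⊕-congˡ : ∀ P {Q Q′ : Poly} → Q ≗ Q′ → P ⊕ Q ≗ P ⊕ Q′
⊕-congˡ P Q≗Q′ k = cong (P k +_) (Q≗Q′ k)

≼-⊕ˡ : ∀ {P Q} → P ≼ P ⊕ Q
≼-⊕ˡ k = m≤m+n _ _

≼-⊕ʳ : ∀ {P Q} → Q ≼ P ⊕ Q
≼-⊕ʳ {P} k = m≤n+m _ (P k)

⊕-assoc : ∀ P Q R → (P ⊕ Q) ⊕ R ≗ P ⊕ (Q ⊕ R)
⊕-assoc P Q R k = +-assoc (P k) (Q k) (R k)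

⊕-interchange : ∀ P Q R S → (P ⊕ Q) ⊕ (R ⊕ S) ≗ (P ⊕ R) ⊕ (Q ⊕ S)
⊕-interchange P Q R S k = lemma (P k) (Q k) (R k) (S k)
  where
  lemma : ∀ a b c d → (a + b) + (c + d) ≡ (a + c) + (b + d)
  lemma = solve-∀

q-mono : ∀ {P Q} → P ≼ Q → q P ≼ q Q
q-mono P≼Q zero    = z≤n
q-mono P≼Q (suc k) = P≼Q k

q-cong : {P Q : Poly} → P ≗ Q → q P ≗ q Q
q-cong P≗Q zero    = refl
q-cong P≗Q (suc k) = P≗Q k

q-⊕ : ∀ P Q → q (P ⊕ Q) ≗ q P ⊕ q Q
q-⊕ P Q zero    = refl
q-⊕ P Q (suc k) = refl

q^-mono : ∀ i {P Q} → P ≼ Q → q^ i P ≼ q^ i Q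
q^-mono zero    P≼Q = P≼Q
q^-mono (suc i) P≼Q = q-mono (q^-mono i P≼Q)

q^-cong : ∀ i {P Q : Poly} → P ≗ Q → q^ i P ≗ q^ i Q
q^-cong zero    P≗Q = P≗Q
q^-cong (suc i) P≗Q = q-cong (q^-cong i P≗Q)

q^-⊕ : ∀ i P Q → q^ i (P ⊕ Q) ≗ q^ i P ⊕ q^ i Q
q^-⊕ zero    P Q k = refl
q^-⊕ (suc i) P Q k = trans (q-cong (q^-⊕ i P Q) k) (q-⊕ (q^ i P) (q^ i Q) k)

q^-𝟘 : ∀ i → q^ i 𝟘 ≗ 𝟘
q^-𝟘 zero    k       = refl
q^-𝟘 (suc i) zero    = refl
q^-𝟘 (suc i) (suc k) = q^-𝟘 i k

q^-+ : ∀ i j P → q^ (i + j) P ≡ q^ i (q^ j P)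
q^-+ zero    j P = refl
q^-+ (suc i) j P = cong q (q^-+ i j P)

q^-comm : ∀ i j P → q^ i (q^ j P) ≡ q^ j (q^ i P)
q^-comm i j P = trans (sym (q^-+ i j P)) (trans (cong (λ l → q^ l P) (+-comm i j)) (q^-+ j i P))

-- The products D_a.

-- mulD a is multiplication by ∏_{0<i<a} (1 + qⁱ).

mulD : ℕ → Poly → Poly
mulD zero          P = P
mulD (suc zero)    P = P
mulD (suc (suc a)) P = mulD (suc a) P ⊕ q^ (suc a) (mulD (suc a) P)

mulD-mono : ∀ a {P Q} → P ≼ Q → mulD a P ≼ mulD a Q
mulD-mono zero          P≼Q = P≼Q
mulD-mono (suc zero)    P≼Q = P≼Q
mulD-mono (suc (suc a)) P≼Q =
  ⊕-mono (mulD-mono (suc a) P≼Q) (q^-mono (suc a) (mulD-mono (suc a) P≼Q))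

mulD-cong : ∀ a {P Q : Poly} → P ≗ Q → mulD a P ≗ mulD a Q
mulD-cong zero            P≗Q = P≗Q
mulD-cong (suc zero)      P≗Q = P≗Q
mulD-cong (suc a@(suc _)) P≗Q = ⊕-cong (mulD-cong a P≗Q) (q^-cong a (mulD-cong a P≗Q))

mulD-⊕ : ∀ a P Q → mulD a (P ⊕ Q) ≗ mulD a P ⊕ mulD a Q
mulD-⊕ zero          P Q k = refl
mulD-⊕ (suc zero)    P Q k = refl
mulD-⊕ (suc b@(suc _)) P Q = begin-equality
  M (P ⊕ Q) ⊕ q^ b (M (P ⊕ Q))             ≈⟨ ⊕-cong (mulD-⊕ b P Q) (q^-cong b (mulD-⊕ b P Q)) ⟩
  (M P ⊕ M Q) ⊕ q^ b (M P ⊕ M Q)           ≈⟨ ⊕-congˡ (M P ⊕ M Q) (q^-⊕ b (M P) (M Q)) ⟩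
  (M P ⊕ M Q) ⊕ (q^ b (M P) ⊕ q^ b (M Q))  ≈⟨ ⊕-interchange (M P) (M Q) (q^ b (M P)) (q^ b (M Q)) ⟩
  (M P ⊕ q^ b (M P)) ⊕ (M Q ⊕ q^ b (M Q))  ∎
  where
  open ≼-Reasoning
  M = mulD b

mulD-q^ : ∀ a i P → mulD a (q^ i P) ≗ q^ i (mulD a P)
mulD-q^ zero          i P k = refl
mulD-q^ (suc zero)    i P k = refl
mulD-q^ (suc b@(suc _)) i P = begin-equality
  M (q^ i P) ⊕ q^ b (M (q^ i P))    ≈⟨ ⊕-cong (mulD-q^ b i P) (q^-cong b (mulD-q^ b i P)) ⟩
  q^ i (M P) ⊕ q^ b (q^ i (M P))    ≡⟨ cong (q^ i (M P) ⊕_) (q^-comm b i (M P)) ⟩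
  q^ i (M P) ⊕ q^ i (q^ b (M P))    ≈⟨ q^-⊕ i (M P) (q^ b (M P)) ⟨
  q^ i (M P ⊕ q^ b (M P))           ∎
  where
  open ≼-Reasoning
  M = mulD b

mulD-suc : ∀ a P → mulD a P ≼ mulD (suc a) P
mulD-suc zero    P = ≼-refl
mulD-suc (suc a) P = ≼-⊕ˡ

q^-mulD-top : ∀ a P → q^ a (mulD a P) ≼ mulD (suc a) P
q^-mulD-top zero    P = ≼-refl
q^-mulD-top (suc a) P = ≼-⊕ʳ {P = mulD (suc a) P}

-- Induction on `a`. For `i = a` the left side is one of the two summands of `mulD (suc a) P`. For
-- smaller `i` both summands of `mulD a P` are bounded by the induction hypothesis, at the exponents
-- `i` and `i - 1`.
q^-mulD : ∀ {i a} → i ≤ a → ∀ P → q^ i (mulD a P) ≼ mulD (suc a) P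
q^-mulD {zero}  {a}           _   P = mulD-suc a P
q^-mulD {suc i} {suc zero}    (s≤s z≤n) P = q^-mulD-top 1 P
q^-mulD {suc i} {suc b@(suc _)} (s≤s i≤b) P =
  [ lower (λ j≤b → q^-mulD j≤b P) , (λ where refl → q^-mulD-top (suc b) P) ]′ (m≤n⇒m<n∨m≡n i≤b)
  where
  open ≼-Reasoning
  M = mulD b P
  lower : (∀ {j} → j ≤ b → q^ j M ≼ mulD (suc b) P) →
          suc i ≤ b → q^ (suc i) (mulD (suc b) P) ≼ mulD (suc (suc b)) P
  lower ih i<b = begin
    -- Writing `suc i + b` as `suc b + i` gives the second summand the factor `q^ (suc b)` that it
    -- carries in the target.
    q^ (suc i) (M ⊕ q^ b M)                  ≈⟨ q^-⊕ (suc i) M (q^ b M) ⟩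
    q^ (suc i) M ⊕ q^ (suc i) (q^ b M)       ≡⟨ cong (λ P → q^ (suc i) M ⊕ q P) (q^-comm i b M) ⟩
    q^ (suc i) M ⊕ q^ (suc b) (q^ i M)       ≲⟨ ⊕-mono (ih i<b) (q^-mono (suc b) (ih i≤b)) ⟩
    mulD (suc b) P ⊕ q^ (suc b) (mulD (suc b) P) ∎

D : ℕ → Poly
D b = mulD b 𝟙

DD : ℕ → ℕ → Poly
DD a b = mulD a (D b)

-- The first factor absorbs up to `a` powers of `q`. If `i = a + j`, the second factor absorbs the
-- remaining `j ≤ b`.
q^-DD : ∀ {i a b} → i ≤ a + b → q^ i (DD a b) ≼ DD (suc a) (suc b)
q^-DD {i} {a} {b} i≤a+b with ≤-total i a
... | inj₁ i≤a = ≼-trans (q^-mulD i≤a (D b)) (mulD-mono (suc a) (mulD-suc b 𝟙))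
... | inj₂ a≤i with m≤n⇒∃[o]m+o≡n a≤i
...   | j , refl = begin
  q^ (a + j) (mulD a (D b))       ≡⟨ q^-+ a j _ ⟩
  q^ a (q^ j (mulD a (D b)))      ≈⟨ q^-cong a (mulD-q^ a j (D b)) ⟨
  q^ a (mulD a (q^ j (D b)))      ≲⟨ q^-mulD-top a _ ⟩
  mulD (suc a) (q^ j (D b))       ≲⟨ mulD-mono (suc a) (q^-mulD (+-cancelˡ-≤ a j b i≤a+b) 𝟙) ⟩
  mulD (suc a) (D (suc b))        ∎
  where open ≼-Reasoning

-- The sums U_m and the recurrence for A_n.

-- conv f m is the sum of f a b over all a + b = m with b > 0.

conv : (ℕ → ℕ → Poly) → ℕ → Poly
conv f zero    = 𝟘
conv f (suc m) = f 0 (suc m) ⊕ conv (λ a b → f (suc a) b) m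

conv-mono : ∀ m {f g} → (∀ a b → a + suc b ≡ m → f a (suc b) ≼ g a (suc b)) →
            conv f m ≼ conv g m
conv-mono zero    f≼g = ≼-refl
conv-mono (suc m) f≼g =
  ⊕-mono (f≼g 0 m refl) (conv-mono m λ a b eq → f≼g (suc a) b (cong suc eq))

conv-⊕ : ∀ m f g → conv f m ⊕ conv g m ≗ conv (λ a b → f a b ⊕ g a b) m
conv-⊕ zero    f g k = refl
conv-⊕ (suc m) f g k =
  trans (⊕-interchange (f 0 (suc m)) (conv (f ∘ suc) m) (g 0 (suc m)) (conv (g ∘ suc) m) k)
        (cong (f 0 (suc m) k + g 0 (suc m) k +_) (conv-⊕ m (f ∘ suc) (g ∘ suc) k))

q^-conv : ∀ i m f → q^ i (conv f m) ≗ conv (λ a b → q^ i (f a b)) m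
q^-conv i zero    f k = q^-𝟘 i k
q^-conv i (suc m) f k =
  trans (q^-⊕ i (f 0 (suc m)) (conv (f ∘ suc) m) k)
        (cong (q^ i (f 0 (suc m)) k +_) (q^-conv i m (f ∘ suc) k))

-- The right side has exactly one term more, the one with `a = m` and `b = 1`.
conv-suc : ∀ m f → conv (λ a b → f a (suc b)) m ≼ conv f (suc m)
conv-suc zero    f k = z≤n
conv-suc (suc m) f k = +-monoʳ-≤ _ (conv-suc m (f ∘ suc) k)

-- The generating function of the avoiders `j L R` with `j = a` and `R` of length `b > 0`. The
-- factor `q^ a` counts the inversions of `j` with the entries of `L`.
T : ℕ → ℕ → Poly
T a b = q^ a (DD a b)

U : ℕ → Poly
U = conv T

A : ℕ → Poly
A zero    = 𝟙
A (suc m) = U m ⊕ q^ m (A m)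

-- Each term absorbs the factor `q` by raising `b`, as q D_b ≤ D_{b+1} for b ≥ 1.
q-U : ∀ m → q (U m) ≼ U (suc m)
q-U m = begin
  q (conv T m)                   ≈⟨ q^-conv 1 m T ⟩
  conv (λ a b → q (T a b)) m     ≲⟨ conv-mono m (λ a b _ → termwise a b) ⟩
  conv (λ a b → T a (suc b)) m   ≲⟨ conv-suc m T ⟩
  conv T (suc m)                 ∎
  where
  open ≼-Reasoning
  termwise : ∀ a b → q (T a (suc b)) ≼ T a (suc (suc b))
  termwise a b = begin
    q (q^ a (DD a (suc b)))         ≡⟨ q^-comm 1 a _ ⟩
    q^ a (q^ 1 (DD a (suc b)))      ≈⟨ q^-cong a (mulD-q^ a 1 (D (suc b))) ⟨
    q^ a (mulD a (q^ 1 (D (suc b)))) ≲⟨ q^-mono a (mulD-mono a (q^-mulD {1} {suc b} (s≤s z≤n) 𝟙)) ⟩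
    q^ a (DD a (suc (suc b)))       ∎

-- In each term one factor `q` turns `q^ a` into `q^ (suc a)`; the other `i ≤ a + b` factors are
-- absorbed by raising both indices of `DD`.
q^-U : ∀ i m → i ≤ m → q^ (suc i) (U m) ≼ U (suc (suc m))
q^-U i m i≤m = begin
  q^ (suc i) (conv T m)                   ≈⟨ q^-conv (suc i) m T ⟩
  conv (λ a b → q^ (suc i) (T a b)) m     ≲⟨ conv-mono m termwise ⟩
  conv (λ a b → T (suc a) (suc b)) m      ≲⟨ conv-suc m (T ∘ suc) ⟩
  conv (T ∘ suc) (suc m)                  ≲⟨ ≼-⊕ʳ {P = T 0 (suc (suc m))} ⟩
  conv T (suc (suc m))                    ∎
  where
  open ≼-Reasoning
  termwise : ∀ a b → a + suc b ≡ m → q^ (suc i) (T a (suc b)) ≼ T (suc a) (suc (suc b))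
  termwise a b refl = begin
    q^ (suc i) (q^ a (DD a (suc b)))   ≡⟨ cong q (q^-comm i a _) ⟩
    q^ (suc a) (q^ i (DD a (suc b)))   ≲⟨ q^-mono (suc a) (q^-DD {i} {a} {suc b} i≤m) ⟩
    q^ (suc a) (DD (suc a) (suc (suc b))) ∎

-- The term of U_{m+1} at (a + 1, b) is paired with the term of U_m at (a, b). After q^a D_a ≤
-- D_{a+1} the two have the common factor q^{a+1} D_{a+1}, and (1 + q^b) D_b = D_{b+1} merges them.
-- The unpaired term at a = 0 is bounded by D_{m+1} ≤ D_{m+2}.
U-absorb : ∀ m → U (suc m) ⊕ q^ (suc m) (U m) ≼ U (suc (suc m))
U-absorb m = begin
  (T 0 (suc m) ⊕ conv (T ∘ suc) m) ⊕ q^ (suc m) (conv T m)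
    ≈⟨ ⊕-assoc (T 0 (suc m)) _ _ ⟩
  T 0 (suc m) ⊕ (conv (T ∘ suc) m ⊕ q^ (suc m) (conv T m))
    ≈⟨ ⊕-congˡ (T 0 (suc m)) (⊕-congˡ (conv (T ∘ suc) m) (q^-conv (suc m) m T)) ⟩
  T 0 (suc m) ⊕ (conv (T ∘ suc) m ⊕ conv (λ a b → q^ (suc m) (T a b)) m)
    ≈⟨ ⊕-congˡ (T 0 (suc m)) (conv-⊕ m _ _) ⟩
  T 0 (suc m) ⊕ conv (λ a b → T (suc a) b ⊕ q^ (suc m) (T a b)) m
    ≲⟨ ⊕-mono (mulD-suc (suc m) 𝟙) (conv-mono m termwise) ⟩
  T 0 (suc (suc m)) ⊕ conv (λ a b → T (suc a) (suc b)) m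
    ≲⟨ ⊕-mono ≼-refl (conv-suc m (T ∘ suc)) ⟩
  conv T (suc (suc m)) ∎
  where
  open ≼-Reasoning
  termwise : ∀ a b → a + suc b ≡ m →
             T (suc a) (suc b) ⊕ q^ (suc m) (T a (suc b)) ≼ T (suc a) (suc (suc b))
  termwise a b refl = begin
    q^ a⁺ M ⊕ q^ (a⁺ + b⁺) (q^ a (mulD a (D b⁺)))
      ≲⟨ ⊕-mono ≼-refl (q^-mono (a⁺ + b⁺) (q^-mulD-top a (D b⁺))) ⟩
    q^ a⁺ M ⊕ q^ (a⁺ + b⁺) M
      ≡⟨ cong (q^ a⁺ M ⊕_) (q^-+ a⁺ b⁺ M) ⟩
    q^ a⁺ M ⊕ q^ a⁺ (q^ b⁺ M)
      ≈⟨ q^-⊕ a⁺ M (q^ b⁺ M) ⟨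
    q^ a⁺ (M ⊕ q^ b⁺ M)
      ≈⟨ q^-cong a⁺ (⊕-congˡ M (mulD-q^ a⁺ b⁺ (D b⁺))) ⟨
    q^ a⁺ (M ⊕ mulD a⁺ (q^ b⁺ (D b⁺)))
      ≈⟨ q^-cong a⁺ (mulD-⊕ a⁺ (D b⁺) (q^ b⁺ (D b⁺))) ⟨
    q^ a⁺ (mulD a⁺ (D b⁺ ⊕ q^ b⁺ (D b⁺))) ∎
    where
    a⁺ = suc a
    b⁺ = suc b
    M  = mulD a⁺ (D b⁺)

-- Monotonicity of A_n.

A-Monotone : ℕ → Set
A-Monotone n = A n ≼ A (suc n)

q-A : ∀ m → A-Monotone m → q (A (suc m)) ≼ A (suc (suc m))
q-A m mono = begin
  q (U m ⊕ q^ m (A m))                  ≈⟨ q-⊕ (U m) (q^ m (A m)) ⟩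
  q (U m) ⊕ q^ (suc m) (A m)            ≲⟨ ⊕-mono (q-U m) (q^-mono (suc m) mono) ⟩
  U (suc m) ⊕ q^ (suc m) (A (suc m))    ∎
  where open ≼-Reasoning

-- Unfolding `A` lowers `m` by one and `i` by two, hence the two base cases. Monotonicity is assumed
-- only up to `suc m`, so that the lemma can be used inside the strong induction of `A-monotone`.
q^-A : ∀ i m → (∀ {j} → j ≤ suc m → A-Monotone j) → i ≤ m → q^ i (A m) ≼ A (suc (suc m))
q^-A zero          m       mono _ = ≼-trans (mono (n≤1+n m)) (mono ≤-refl)
q^-A (suc zero)    (suc m) mono _ =
  ≼-trans (q-A m (mono (m≤n+m m 2))) (mono ≤-refl)
q^-A (suc (suc i)) (suc m) mono (s≤s i<m) = begin
  q^ (2 + i) (U m ⊕ q^ m (A m))                 ≈⟨ q^-⊕ (2 + i) (U m) _ ⟩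
  -- `q^ (2 + m)` is the factor of the last summand of `A (3 + m)`, so the exponents `2 + i` and `m`
  -- are regrouped as `2 + m` and `i`.
  q^ (2 + i) (U m) ⊕ q^ (2 + i) (q^ m (A m))    ≡⟨ cong (λ P → q^ (2 + i) (U m) ⊕ q (q P)) (q^-comm i m (A m)) ⟩
  q^ (2 + i) (U m) ⊕ q^ (2 + m) (q^ i (A m))    ≲⟨ ⊕-mono (q^-U (suc i) m i<m) (q^-mono (2 + m) ih) ⟩
  U (2 + m) ⊕ q^ (2 + m) (A (2 + m))            ∎
  where
  open ≼-Reasoning
  ih : q^ i (A m) ≼ A (2 + m)
  ih = q^-A i m (λ j≤1+m → mono (m≤n⇒m≤1+n j≤1+m)) (<⇒≤ i<m)

A-monotone : ∀ n → A-Monotone n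
A-monotone = <-rec A-Monotone step
  where
  step : ∀ n → (∀ {m} → m < n → A-Monotone m) → A-Monotone n
  -- The general step splits a factor q^n off q^{n-1} q^{n-2}, which requires 2n - 3 ≥ n. The
  -- lengths 0, 1 and 2 are checked by coefficients: A_0 = A_1 = 1, A_2 = 1 + q and A_3 = 1 + 2q +
  -- q^2 + q^3.
  step 0 rec = ≼-refl
  step 1 rec = λ where
    zero          → s≤s z≤n
    (suc zero)    → z≤n
    (suc (suc k)) → z≤n
  step 2 rec = λ where
    zero                   → ≤-refl
    (suc zero)             → s≤s z≤n
    (suc (suc zero))       → z≤n
    (suc (suc (suc k)))    → z≤n
  step (suc (suc (suc m))) rec = begin
    U (2 + m) ⊕ q^ (2 + m) (U (1 + m) ⊕ q^ (1 + m) (A (1 + m)))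
      ≈⟨ ⊕-congˡ (U (2 + m)) (q^-⊕ (2 + m) (U (1 + m)) _) ⟩
    U (2 + m) ⊕ (q^ (2 + m) (U (1 + m)) ⊕ q^ (2 + m) (q^ (1 + m) (A (1 + m))))
      ≈⟨ ⊕-assoc (U (2 + m)) _ _ ⟨
    (U (2 + m) ⊕ q^ (2 + m) (U (1 + m))) ⊕ q^ (2 + m) (q^ (1 + m) (A (1 + m)))
      ≡⟨ cong ((U (2 + m) ⊕ q^ (2 + m) (U (1 + m))) ⊕_) shift ⟩
    (U (2 + m) ⊕ q^ (2 + m) (U (1 + m))) ⊕ q^ (3 + m) (q^ m (A (1 + m)))
      -- `q^-A` at `1 + m` asks for monotonicity up to `2 + m`, which are exactly lengths that the
      -- strong induction provides.
      ≲⟨ ⊕-mono (U-absorb (1 + m)) (q^-mono (3 + m) (q^-A m (1 + m) (λ j≤ → rec (s≤s j≤)) (n≤1+n m))) ⟩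
    U (3 + m) ⊕ q^ (3 + m) (A (3 + m)) ∎
    where
    open ≼-Reasoning
    shift : q^ (2 + m) (q^ (1 + m) (A (1 + m))) ≡ q^ (3 + m) (q^ m (A (1 + m)))
    shift = q^-comm (2 + m) 1 (q^ m (A (1 + m)))

-- Words

Word : Set
Word = List ℕ

module _ {X : Set} where

  Unique-resp-⊆ : {xs ys : List X} → xs ⊆ ys → Unique ys → Unique xs
  Unique-resp-⊆ []         []       = []
  Unique-resp-⊆ (y ∷ʳ σ)   (_ ∷ u)  = Unique-resp-⊆ σ u
  Unique-resp-⊆ (refl ∷ σ) (y∉ ∷ u) = All-resp-⊆ σ y∉ ∷ Unique-resp-⊆ σ u

  ⊆-++⁻ : ∀ {xs} (ys : List X) {zs} → xs ⊆ ys ++ zs →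
          ∃₂ λ us vs → xs ≡ us ++ vs × us ⊆ ys × vs ⊆ zs
  ⊆-++⁻ []       σ          = [] , _ , refl , [] , σ
  ⊆-++⁻ (y ∷ ys) (.y ∷ʳ σ)  with us , vs , eq , σ₁ , σ₂ ← ⊆-++⁻ ys σ =
    us , vs , eq , y ∷ʳ σ₁ , σ₂
  ⊆-++⁻ (y ∷ ys) (refl ∷ σ) with us , vs , refl , σ₁ , σ₂ ← ⊆-++⁻ ys σ =
    y ∷ us , vs , refl , refl ∷ σ₁ , σ₂

  ⊆-map⁻ : ∀ {Y : Set} (f : X → Y) xs {ys} → ys ⊆ map f xs →
           ∃[ zs ] ys ≡ map f zs × zs ⊆ xs
  ⊆-map⁻ f []       []         = [] , refl , []
  ⊆-map⁻ f (x ∷ xs) (_ ∷ʳ σ)   with zs , eq , τ ← ⊆-map⁻ f xs σ = zs , eq , x ∷ʳ τ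
  ⊆-map⁻ f (x ∷ xs) (refl ∷ σ) with zs , refl , τ ← ⊆-map⁻ f xs σ =
    x ∷ zs , refl , refl ∷ τ

  ∈-pair : ∀ {x y} {xs : List X} → x ∈ xs → y ∈ xs → x ≢ y →
           x ∷ y ∷ [] ⊆ xs ⊎ y ∷ x ∷ [] ⊆ xs
  ∈-pair (here refl) (here refl) x≢y = contradiction refl x≢y
  ∈-pair (here refl) (there y∈)  _   = inj₁ (refl ∷ from∈ y∈)
  ∈-pair (there x∈)  (here refl) _   = inj₂ (refl ∷ from∈ x∈)
  ∈-pair (there x∈)  (there y∈)  x≢y = [ inj₁ ∘ (_ ∷ʳ_) , inj₂ ∘ (_ ∷ʳ_) ]′ (∈-pair x∈ y∈ x≢y)

-- The one-line notation of a permutation of 0, ..., n - 1. That every value occurs is a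
-- consequence, drawn in `Perm-∈` by the pigeonhole principle.
record Perm (n : ℕ) (w : Word) : Set where
  constructor perm
  field
    length≡ : length w ≡ n
    unique  : Unique w
    bounded : All (_< n) w
open Perm

lookup-injective : ∀ {w : Word} → Unique w → ∀ {i j} → lookup w i ≡ lookup w j → i ≡ j
lookup-injective (_ ∷ _)  {Fin.zero}  {Fin.zero}  _  = refl
lookup-injective (x∉ ∷ _) {Fin.zero}  {Fin.suc j} eq = contradiction eq (All.lookup x∉ (∈-lookup j))
lookup-injective (x∉ ∷ _) {Fin.suc i} {Fin.zero}  eq = contradiction (sym eq) (All.lookup x∉ (∈-lookup i))
lookup-injective (_ ∷ u)  {Fin.suc i} {Fin.suc j} eq = cong Fin.suc (lookup-injective u eq)

pigeonhole : ∀ {n w} → Unique w → All (_< n) w → length w ≤ n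
pigeonhole {n} {w} u b = injective⇒≤ λ {i} {j} eq →
  lookup-injective u (fromℕ<-injective _ _ (lookup< i) (lookup< j) eq)
  where
  lookup< : ∀ i → lookup w i < n
  lookup< i = All.lookup b (∈-lookup i)

-- If `x` were missing, `x ∷ w` would consist of `n + 1` distinct entries below `n`.
Perm-∈ : ∀ {n w x} → Perm n w → x < n → x ∈ w
Perm-∈ {n} {w} {x} p x<n with x ∈? w
... | yes x∈w = x∈w
... | no  x∉w = contradiction
  (pigeonhole (All.tabulate (λ { y∈w refl → x∉w y∈w }) ∷ unique p) (x<n ∷ bounded p))
  (subst (λ l → ¬ (suc l ≤ n)) (sym (length≡ p)) (n≮n n))

Perm-0 : ∀ {w} → Perm 0 w → w ≡ []
Perm-0 {[]} _ = refl

Perm-∷ : ∀ {n w} → Perm n w → Perm (suc n) (n ∷ w)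
Perm-∷ (perm l u b) =
  perm (cong suc l) (All.map >⇒≢ b ∷ u) (n<1+n _ ∷ All.map m<n⇒m<1+n b)

Perm-∷⁻ : ∀ {n w} → Perm (suc n) (n ∷ w) → Perm n w
Perm-∷⁻ (perm l (n∉ ∷ u) (_ ∷ b)) =
  perm (suc-injective l) u (All.zipWith (λ (n≢x , x<1+n) → ≤∧≢⇒< (s≤s⁻¹ x<1+n) (n≢x ∘ sym)) (n∉ , b))

Perm-∷ʳ : ∀ {n w} → Perm n w → Perm (suc n) (w ▷ n)
Perm-∷ʳ {n} {w} (perm l u b) = perm
  (trans (length-++-comm w [ n ]) (cong suc l))
  (Uniqueₚ.++⁺ u ([] ∷ []) λ { (x∈w , here refl) → n≮n n (All.lookup b x∈w) })
  (Allₚ.∷ʳ⁺ (All.map m<n⇒m<1+n b) (n<1+n n))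

Perm-∷ʳ⁻ : ∀ {n w} → Perm (suc n) (w ▷ n) → Perm n w
Perm-∷ʳ⁻ {n} {w} (perm l u b) = perm
  (suc-injective (trans (length-++-comm [ n ] w) l))
  (Unique-resp-⊆ (++⁺ʳ [ n ] ⊆-refl) u)
  (All.tabulate λ {x} x∈w → ≤∧≢⇒< (s≤s⁻¹ (All.lookup (Allₚ.++⁻ˡ w b) x∈w)) (x≢n x∈w))
  where
  x≢n : ∀ {x} → x ∈ w → x ≢ n
  x≢n x∈w with (x≢n′ ∷ []) ∷ _ ← Unique-resp-⊆ (++⁺ (from∈ x∈w) (⊆-refl {x = [ n ]})) u = x≢n′

-- `R` is kept standardised, so that it is itself a permutation, and is lifted above `j`. The
-- instance `join 0 []` puts a new minimum in front.
join : ℕ → Word → Word → Word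
join j L R = j ∷ L ++ map (suc j +_) R


Perm-join : ∀ {j b L R} → Perm j L → Perm b R → Perm (suc (j + b)) (join j L R)
Perm-join {j} {b} {L} {R} (perm lL uL bL) (perm lR uR bR) = perm
  (cong suc (trans (length-++ L) (cong₂ _+_ lL (trans (length-map _ R) lR))))
  (Allₚ.++⁺ (All.map >⇒≢ bL) (Allₚ.map⁺ (All.universal (λ x → <⇒≢ (m≤m+n (suc j) x)) R))
    ∷ Uniqueₚ.++⁺ uL (Uniqueₚ.map⁺ (+-cancelˡ-≡ (suc j) _ _) uR) disjoint)
  (s≤s (m≤m+n j b)
    ∷ Allₚ.++⁺ (All.map (λ x<j → <-≤-trans x<j (≤-trans (m≤m+n j b) (n≤1+n _))) bL)
              (Allₚ.map⁺ (All.map (+-monoʳ-< (suc j)) bR)))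
  where
  disjoint : ∀ {x} → ¬ (x ∈ L × x ∈ map (suc j +_) R)
  disjoint (x∈L , x∈R) with y , _ , refl ← ∈-map⁻ (suc j +_) x∈R =
    <-asym (All.lookup bL x∈L) (m≤m+n (suc j) y)

-- Pattern avoidance in words

infix 4 _avoids_

_avoids_ : Word → (ℕ → ℕ → ℕ → Set) → Set
w avoids p = ∀ {a b c} → a ∷ b ∷ c ∷ [] ⊆ w → ¬ p a b c

-- A pattern is a relation between the values of three entries read from left to right. Two
-- inequalities between neighbouring values fix the order; the third comparison follows by
-- transitivity.
⟨132⟩ ⟨213⟩ ⟨231⟩ : ℕ → ℕ → ℕ → Set
⟨132⟩ a b c = a < c × c < b
⟨213⟩ a b c = b < a × a < c
⟨231⟩ a b c = c < a × a < b

Avoids1324 : Word → Set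
Avoids1324 w = ∀ {a b c d} → a ∷ b ∷ c ∷ d ∷ [] ⊆ w → ¬ (a < c × c < b × b < d)

avoids-resp-⊆ : ∀ {p v w} → v ⊆ w → w avoids p → v avoids p
avoids-resp-⊆ v⊆w av σ = av (⊆-trans σ v⊆w)

avoids-∷ : ∀ {p x w} → (∀ {b c} → b ∷ c ∷ [] ⊆ w → ¬ p x b c) → w avoids p → x ∷ w avoids p
avoids-∷ head av (_ ∷ʳ σ)   = av σ
avoids-∷ head av (refl ∷ σ) = head σ

avoids-∷ʳ : ∀ {p w x} → (∀ {a b} → a ∷ b ∷ [] ⊆ w → ¬ p a b x) → w avoids p → w ▷ x avoids p
avoids-∷ʳ {w = w} last av σ with ⊆-++⁻ w σ
... | _ ∷ _ ∷ []     , _ ∷ [] , refl , σ₁ , refl ∷ [] = last σ₁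
... | _ ∷ _ ∷ _ ∷ [] , []     , refl , σ₁ , _         = av σ₁
... | []             , _      , refl , _  , _ ∷ ()
... | _ ∷ []         , _      , refl , _  , _ ∷ ()

avoids-map : ∀ {p} f → (∀ {a b c} → p (f a) (f b) (f c) → p a b c) →
             ∀ {w} → w avoids p → map f w avoids p
avoids-map f reflect {w} av σ with ⊆-map⁻ f w σ
... | a ∷ b ∷ c ∷ [] , refl , τ = av τ ∘ reflect

avoids-map⁻ : ∀ {p} f → (∀ {a b c} → p a b c → p (f a) (f b) (f c)) →
              ∀ {w} → map f w avoids p → w avoids p
avoids-map⁻ f preserve av σ = av (map⁺ f σ) ∘ preserve

shift-⟨⟩ : ∀ k {a b c d} → a < b × c < d → k + a < k + b × k + c < k + d
shift-⟨⟩ k (a<b , c<d) = +-monoʳ-< k a<b , +-monoʳ-< k c<d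

unshift-⟨⟩ : ∀ k {a b c d} → k + a < k + b × k + c < k + d → a < b × c < d
unshift-⟨⟩ k (a<b , c<d) = +-cancelˡ-< k _ _ a<b , +-cancelˡ-< k _ _ c<d

-- Classes of avoiders and their recursive enumeration.

record Perm₂₃₁ (p : ℕ → ℕ → ℕ → Set) (n : ℕ) (w : Word) : Set where
  field
    isPerm : Perm n w
    av231  : w avoids ⟨231⟩
    av     : w avoids p

record Perm₁₃₂₄ (n : ℕ) (w : Word) : Set where
  field
    isPerm : Perm n w
    av231  : w avoids ⟨231⟩
    av1324 : Avoids1324 w

-- The first class is grown by a maximum at either end, the second by a minimum or a maximum in
-- front. At length 0 both insertions give the same word, so only one is listed.
grow₁₃₂ grow₂₁₃ : ℕ → List Word → List Word
grow₁₃₂ zero      ws = map (0 ∷_) ws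
grow₁₃₂ n@(suc _) ws = map (_▷ n) ws ++ map (n ∷_) ws
grow₂₁₃ zero      ws = map (0 ∷_) ws
grow₂₁₃ n@(suc _) ws = map (join 0 []) ws ++ map (n ∷_) ws

words₁₃₂ words₂₁₃ : ℕ → List Word
words₁₃₂ zero    = [ [] ]
words₁₃₂ (suc n) = grow₁₃₂ n (words₁₃₂ n)
words₂₁₃ zero    = [ [] ]
words₂₁₃ (suc n) = grow₂₁₃ n (words₂₁₃ n)

-- mixed s m lists the words j L R with s ≤ j < s + m and R of length s + m − j.

mixed : ℕ → ℕ → List Word
mixed j zero    = []
mixed j (suc m) =
  cartesianProductWith (join j) (words₁₃₂ j) (words₂₁₃ (suc m)) ++ mixed (suc j) m

words₁₃₂₄ : ℕ → List Word
words₁₃₂₄ zero    = [ [] ]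
words₁₃₂₄ (suc n) = mixed 0 n ++ map (n ∷_) (words₁₃₂₄ n)

-- Soundness: the listed words are avoiders.

max-first-avoids : ∀ {n w} p → (∀ {b c} → b < n → c < n → ¬ p n b c) →
                   All (_< n) w → w avoids p → n ∷ w avoids p
max-first-avoids {n} {w} p impossible w<n = avoids-∷ {p} λ σ →
  impossible (All.lookup w<n (to∈ (⊆-trans (refl ∷ minimum _) σ)))
             (All.lookup w<n (to∈ (⊆-trans (_ ∷ʳ refl ∷ []) σ)))

first-avoids231 : ∀ {n w} → All (_< n) w → w avoids ⟨231⟩ → n ∷ w avoids ⟨231⟩
first-avoids231 = max-first-avoids ⟨231⟩ λ b<n _ (_ , n<b) → <-asym n<b b<n

Perm₁₃₂-∷ : ∀ {n w} → Perm₂₃₁ ⟨132⟩ n w → Perm₂₃₁ ⟨132⟩ (suc n) (n ∷ w)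
Perm₁₃₂-∷ P = record
  { isPerm = Perm-∷ isPerm
  ; av231  = first-avoids231 (bounded isPerm) av231
  ; av     = max-first-avoids ⟨132⟩ (λ _ c<n (n<c , _) → <-asym n<c c<n) (bounded isPerm) av
  }
  where open Perm₂₃₁ P

Perm₂₁₃-∷ : ∀ {n w} → Perm₂₃₁ ⟨213⟩ n w → Perm₂₃₁ ⟨213⟩ (suc n) (n ∷ w)
Perm₂₁₃-∷ P = record
  { isPerm = Perm-∷ isPerm
  ; av231  = first-avoids231 (bounded isPerm) av231
  ; av     = max-first-avoids ⟨213⟩ (λ _ c<n (_ , n<c) → <-asym n<c c<n) (bounded isPerm) av
  }
  where open Perm₂₃₁ P

Perm₁₃₂-∷ʳ : ∀ {n w} → Perm₂₃₁ ⟨132⟩ n w → Perm₂₃₁ ⟨132⟩ (suc n) (w ▷ n)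
Perm₁₃₂-∷ʳ P = record
  { isPerm = Perm-∷ʳ isPerm
  ; av231  = avoids-∷ʳ {⟨231⟩} (λ σ (n<a , _) → <-asym n<a (bound (⊆-trans (refl ∷ minimum _) σ))) av231
  ; av     = avoids-∷ʳ {⟨132⟩} (λ σ (_ , n<b) → <-asym n<b (bound (⊆-trans (_ ∷ʳ refl ∷ []) σ))) av
  }
  where
  open Perm₂₃₁ P
  bound : ∀ {x} → [ x ] ⊆ _ → x < _
  bound σ = All.lookup (bounded isPerm) (to∈ σ)

-- A leading 0 cannot begin a 231 or a 213, since both have a smaller letter later.
Perm₂₁₃-join : ∀ {n w} → Perm₂₃₁ ⟨213⟩ n w → Perm₂₃₁ ⟨213⟩ (suc n) (join 0 [] w)
Perm₂₁₃-join P = record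
  { isPerm = Perm-join (perm refl [] []) isPerm
  ; av231  = avoids-∷ {⟨231⟩} (λ _ ()) (avoids-map {⟨231⟩} suc (unshift-⟨⟩ 1) av231)
  ; av     = avoids-∷ {⟨213⟩} (λ _ ()) (avoids-map {⟨213⟩} suc (unshift-⟨⟩ 1) av)
  }
  where open Perm₂₃₁ P

Perm₂₃₁-[] : ∀ {p} → Perm₂₃₁ p 0 []
Perm₂₃₁-[] = record { isPerm = perm refl [] [] ; av231 = λ () ; av = λ () }

grow₁₃₂-sound : ∀ n {ws} → (∀ {w} → w ∈ ws → Perm₂₃₁ ⟨132⟩ n w) →
                ∀ {w} → w ∈ grow₁₃₂ n ws → Perm₂₃₁ ⟨132⟩ (suc n) w
grow₁₃₂-sound zero          sound w∈ with v , v∈ , refl ← ∈-map⁻ (0 ∷_) w∈ = Perm₁₃₂-∷ (sound v∈)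
grow₁₃₂-sound n@(suc _) {ws} sound w∈ with ∈-++⁻ (map (_▷ n) ws) w∈
... | inj₁ w∈ʳ with v , v∈ , refl ← ∈-map⁻ (_▷ n) w∈ʳ = Perm₁₃₂-∷ʳ (sound v∈)
... | inj₂ w∈ˡ with v , v∈ , refl ← ∈-map⁻ (n ∷_) w∈ˡ = Perm₁₃₂-∷ (sound v∈)

grow₂₁₃-sound : ∀ n {ws} → (∀ {w} → w ∈ ws → Perm₂₃₁ ⟨213⟩ n w) →
                ∀ {w} → w ∈ grow₂₁₃ n ws → Perm₂₃₁ ⟨213⟩ (suc n) w
grow₂₁₃-sound zero          sound w∈ with v , v∈ , refl ← ∈-map⁻ (0 ∷_) w∈ = Perm₂₁₃-∷ (sound v∈)
grow₂₁₃-sound n@(suc _) {ws} sound w∈ with ∈-++⁻ (map (join 0 []) ws) w∈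
... | inj₁ w∈ʲ with v , v∈ , refl ← ∈-map⁻ (join 0 []) w∈ʲ = Perm₂₁₃-join (sound v∈)
... | inj₂ w∈ˡ with v , v∈ , refl ← ∈-map⁻ (n ∷_) w∈ˡ = Perm₂₁₃-∷ (sound v∈)

words₁₃₂-sound : ∀ n {w} → w ∈ words₁₃₂ n → Perm₂₃₁ ⟨132⟩ n w
words₁₃₂-sound zero    (here refl) = Perm₂₃₁-[]
words₁₃₂-sound (suc n)             = grow₁₃₂-sound n (words₁₃₂-sound n)

words₂₁₃-sound : ∀ n {w} → w ∈ words₂₁₃ n → Perm₂₃₁ ⟨213⟩ n w
words₂₁₃-sound zero    (here refl) = Perm₂₃₁-[]
words₂₁₃-sound (suc n)             = grow₂₁₃-sound n (words₂₁₃-sound n)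

-- All entries of `L` lie below those of `R`, so a larger entry followed by a smaller one cannot
-- straddle the two blocks. This confines a 231 to one block. In a 1324 the 3 and the 2 share a
-- block: in `R` they form a 213 with the 4, in `L` a 132 with the 1.
join-sound : ∀ {j b L R} → Perm₂₃₁ ⟨132⟩ j L → Perm₂₃₁ ⟨213⟩ b R → Perm₁₃₂₄ (suc (j + b)) (join j L R)
join-sound {j} {b} {L} {R} PL PR = record
  { isPerm = Perm-join PL.isPerm PR.isPerm
  ; av231  = avoids-∷ {⟨231⟩} first231 rest231
  ; av1324 = both1324
  }
  where
  module PL = Perm₂₃₁ PL
  module PR = Perm₂₃₁ PR
  R⁺ : Word
  R⁺ = map (suc j +_) R

  below : ∀ {x xs} → x ∷ xs ⊆ L → x < j
  below σ = All.lookup (bounded PL.isPerm) (to∈ (⊆-trans (refl ∷ minimum _) σ))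

  above : ∀ {x xs} → x ∷ xs ⊆ R⁺ → j < x
  above σ with y , _ , refl ← ∈-map⁻ (suc j +_) (to∈ (⊆-trans (refl ∷ minimum _) σ)) = m≤m+n (suc j) y

  tail⊆ : ∀ {x : ℕ} {xs ys} → x ∷ xs ⊆ ys → xs ⊆ ys
  tail⊆ = ⊆-trans (_ ∷ʳ ⊆-refl)

  R⁺-av231 : R⁺ avoids ⟨231⟩
  R⁺-av231 = avoids-map {⟨231⟩} (suc j +_) (unshift-⟨⟩ (suc j)) PR.av231

  R⁺-av213 : R⁺ avoids ⟨213⟩
  R⁺-av213 = avoids-map {⟨213⟩} (suc j +_) (unshift-⟨⟩ (suc j)) PR.av

  first231 : ∀ {b c} → b ∷ c ∷ [] ⊆ L ++ R⁺ → ¬ ⟨231⟩ j b c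
  first231 σ (c<j , j<b) with ⊆-++⁻ L σ
  ... | []         , _ , refl , _  , σ₂ = <-asym c<j (above (tail⊆ σ₂))
  ... | _ ∷ []     , _ , refl , σ₁ , _  = <-asym j<b (below σ₁)
  ... | _ ∷ _ ∷ [] , _ , refl , σ₁ , _  = <-asym j<b (below σ₁)

  rest231 : L ++ R⁺ avoids ⟨231⟩
  rest231 σ (c<a , a<b) with ⊆-++⁻ L σ
  ... | []             , _ , refl , _  , σ₂ = R⁺-av231 σ₂ (c<a , a<b)
  ... | _ ∷ []         , _ , refl , σ₁ , σ₂ = <-asym c<a (<-trans (below σ₁) (above (tail⊆ σ₂)))
  ... | _ ∷ _ ∷ []     , _ , refl , σ₁ , σ₂ = <-asym c<a (<-trans (below σ₁) (above σ₂))
  ... | _ ∷ _ ∷ _ ∷ [] , [] , refl , σ₁ , _ = PL.av231 σ₁ (c<a , a<b)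

  both1324 : Avoids1324 (join j L R)
  -- Here `j` plays the 1, so the other three letters exceed `j` and lie in `R`.
  both1324 (refl ∷ σ) (j<c , c<b , b<d) with ⊆-++⁻ L σ
  ... | []    , _ , refl , _  , σ₂ = R⁺-av213 σ₂ (c<b , b<d)
  ... | _ ∷ []         , _ , refl , σ₁ , _  = <-asym (<-trans j<c c<b) (below σ₁)
  ... | _ ∷ _ ∷ []     , _ , refl , σ₁ , _  = <-asym (<-trans j<c c<b) (below σ₁)
  ... | _ ∷ _ ∷ _ ∷ [] , _ , refl , σ₁ , _  = <-asym (<-trans j<c c<b) (below σ₁)
  both1324 (_ ∷ʳ σ) (a<c , c<b , b<d) with ⊆-++⁻ L σ
  ... | []                 , _ , refl , _  , σ₂ = R⁺-av213 (tail⊆ σ₂) (c<b , b<d)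
  ... | _ ∷ []             , _ , refl , _  , σ₂ = R⁺-av213 σ₂ (c<b , b<d)
  ... | _ ∷ _ ∷ []         , _ , refl , σ₁ , σ₂ = <-asym c<b (<-trans (below (tail⊆ σ₁)) (above σ₂))
  ... | _ ∷ _ ∷ _ ∷ []     , _ , refl , σ₁ , _  = PL.av σ₁ (a<c , c<b)
  ... | _ ∷ _ ∷ _ ∷ _ ∷ [] , _ , refl , σ₁ , _  = PL.av (⊆-trans (refl ∷ refl ∷ refl ∷ (_ ∷ʳ [])) σ₁) (a<c , c<b)

mixed-sound : ∀ j m {w} → w ∈ mixed j m → Perm₁₃₂₄ (suc (j + m)) w
mixed-sound j (suc m) {w} w∈
  with ∈-++⁻ (cartesianProductWith (join j) (words₁₃₂ j) (words₂₁₃ (suc m))) w∈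
... | inj₂ w∈′ = subst (λ n → Perm₁₃₂₄ (suc n) w) (sym (+-suc j m)) (mixed-sound (suc j) m w∈′)
... | inj₁ w∈′
  with L , R , L∈ , R∈ , refl ← ∈-cartesianProductWith⁻ (join j) (words₁₃₂ j) (words₂₁₃ (suc m)) w∈′ =
  join-sound (words₁₃₂-sound j L∈) (words₂₁₃-sound (suc m) R∈)

words₁₃₂₄-sound : ∀ n {w} → w ∈ words₁₃₂₄ n → Perm₁₃₂₄ n w
words₁₃₂₄-sound zero    (here refl) = record
  { isPerm = perm refl [] [] ; av231 = λ () ; av1324 = λ () }
words₁₃₂₄-sound (suc n) w∈ with ∈-++⁻ (mixed 0 n) w∈
... | inj₁ w∈′ = mixed-sound 0 n w∈′
... | inj₂ w∈′ with v , v∈ , refl ← ∈-map⁻ (n ∷_) w∈′ = record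
  { isPerm = Perm-∷ isPerm
  ; av231  = first-avoids231 (bounded isPerm) av231
  ; av1324 = λ where
      (_ ∷ʳ σ)   → av1324 σ
      (refl ∷ σ) (n<c , _) → <-asym n<c (All.lookup (bounded isPerm) (to∈ (⊆-trans (_ ∷ʳ refl ∷ minimum _) σ)))
  }
  where open Perm₁₃₂₄ (words₁₃₂₄-sound n v∈)

-- Completeness: every avoider is listed.

-- The cut is at the first entry above `j`: a later entry below `j` would complete a 231 in which
-- `j` is the 2.
split-at : ∀ j w → All (j ≢_) w → (∀ {b c} → b ∷ c ∷ [] ⊆ w → ¬ ⟨231⟩ j b c) →
           ∃₂ λ L R → w ≡ L ++ R × All (_< j) L × All (j <_) R
split-at j []      _          _  = [] , [] , refl , [] , []
split-at j (x ∷ w) (j≢x ∷ j∉) av with <-cmp x j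
... | tri≈ _ refl _ = contradiction refl j≢x
... | tri> _ _ j<x  = [] , x ∷ w , refl , [] ,
  j<x ∷ All.tabulate λ y∈w →
    ≤∧≢⇒< (≮⇒≥ λ y<j → av (refl ∷ from∈ y∈w) (y<j , j<x)) (All.lookup j∉ y∈w)
... | tri< x<j _ _  with L , R , refl , L<j , j<R ← split-at j w j∉ (λ σ → av (x ∷ʳ σ)) =
  x ∷ L , R , refl , x<j ∷ L<j , j<R

unshift : ∀ j w → All (j <_) w → ∃[ R ] w ≡ map (suc j +_) R
unshift j []      []          = [] , refl
unshift j (x ∷ w) (j<x ∷ j<w)
  with y , refl ← m≤n⇒∃[o]m+o≡n j<x | R , refl ← unshift j w j<w = y ∷ R , refl

-- By the pigeonhole principle `L` has at most `j` entries and `R` at most `b`. The lengths add up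
-- to `j + b`, so both bounds are attained.
Perm-join⁻ : ∀ {n j} L R → Perm (suc n) (join j L R) → All (_< j) L →
             ∃[ b ] j + b ≡ n × Perm j L × Perm b R
Perm-join⁻ {n} {j} L R (perm l (_ ∷ u) (j<1+n ∷ bound)) L<j
  with b , refl ← m≤n⇒∃[o]m+o≡n (s≤s⁻¹ j<1+n) =
  b , refl , perm (≤-antisym L≤ (+-cancelʳ-≤ b j _ (≤-trans (≤-reflexive (sym lengths)) (+-monoʳ-≤ (length L) R≤)))) uL L<j
           , perm (≤-antisym R≤ (+-cancelˡ-≤ j b _ (≤-trans (≤-reflexive (sym lengths)) (+-monoˡ-≤ (length R) L≤)))) uR R<b
  where
  uL = Unique-resp-⊆ (++⁺ʳ (map (suc j +_) R) ⊆-refl) u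
  uR = Uniqueₚ.map⁻ (Unique-resp-⊆ (++⁺ˡ L ⊆-refl) u)
  R<b : All (_< b) R
  R<b = All.map (+-cancelˡ-< (suc j) _ b) (Allₚ.map⁻ (Allₚ.++⁻ʳ L bound))
  L≤ : length L ≤ j
  L≤ = pigeonhole uL L<j
  R≤ : length R ≤ b
  R≤ = pigeonhole uR R<b
  lengths : length L + length R ≡ j + b
  lengths = begin
    length L + length R                    ≡⟨ cong (length L +_) (length-map (suc j +_) R) ⟨
    length L + length (map (suc j +_) R)   ≡⟨ length-++ L ⟨
    length (L ++ map (suc j +_) R)         ≡⟨ suc-injective l ⟩
    j + b                                  ∎
    where open ≡-Reasoning

⊆-tail : ∀ {x : ℕ} {w} → w ⊆ x ∷ w
⊆-tail = _ ∷ʳ ⊆-refl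

Perm₂₃₁-∷⁻ : ∀ {p n w} → Perm₂₃₁ p (suc n) (n ∷ w) → Perm₂₃₁ p n w
Perm₂₃₁-∷⁻ {p} P = record
  { isPerm = Perm-∷⁻ isPerm
  ; av231  = avoids-resp-⊆ {⟨231⟩} ⊆-tail av231
  ; av     = avoids-resp-⊆ {p} ⊆-tail av
  }
  where open Perm₂₃₁ P

Perm₂₃₁-∷ʳ⁻ : ∀ {p n w} → Perm₂₃₁ p (suc n) (w ▷ n) → Perm₂₃₁ p n w
Perm₂₃₁-∷ʳ⁻ {p} {n} P = record
  { isPerm = Perm-∷ʳ⁻ isPerm
  ; av231  = avoids-resp-⊆ {⟨231⟩} (++⁺ʳ [ n ] ⊆-refl) av231
  ; av     = avoids-resp-⊆ {p} (++⁺ʳ [ n ] ⊆-refl) av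
  }
  where open Perm₂₃₁ P

Perm-≢ : ∀ {n w x y} → Perm n w → x ∷ y ∷ [] ⊆ w → x ≢ y
Perm-≢ P σ with (x≢y ∷ []) ∷ _ ← Unique-resp-⊆ σ (unique P) = x≢y

Perm-< : ∀ {n w x} → Perm (suc n) w → x ∈ w → x ≢ n → x < n
Perm-< P x∈w = ≤∧≢⇒< (s≤s⁻¹ (All.lookup (bounded P) x∈w))

-- If the maximum `n` is neither first nor last, compare the first entry `x` with the entry `y`
-- right after `n`: the subsequence `x n y` is a 132 or a 231.
grow₁₃₂-complete : ∀ n {ws} → (∀ {w} → Perm₂₃₁ ⟨132⟩ n w → w ∈ ws) →
                   ∀ {w} → Perm₂₃₁ ⟨132⟩ (suc n) w → w ∈ grow₁₃₂ n ws
grow₁₃₂-complete n {ws} complete {w} P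
  with ∈-∃++ (Perm-∈ (Perm₂₃₁.isPerm P) (n<1+n n))
... | [] , v , refl = atFront n v (complete (Perm₂₃₁-∷⁻ P))
  where
  atFront : ∀ n v → v ∈ ws → n ∷ v ∈ grow₁₃₂ n ws
  atFront zero      v v∈ = ∈-map⁺ (0 ∷_) v∈
  atFront n@(suc _) v v∈ = ∈-++⁺ʳ (map (_▷ n) ws) (∈-map⁺ (n ∷_) v∈)
... | x ∷ u , [] , refl = atEnd n (x ∷ u) (length≡ (Perm₂₃₁.isPerm P′)) (complete P′)
  where
  P′ = Perm₂₃₁-∷ʳ⁻ P
  atEnd : ∀ n v → length v ≡ n → v ∈ ws → v ▷ n ∈ grow₁₃₂ n ws
  atEnd zero      [] refl v∈ = ∈-map⁺ (0 ∷_) v∈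
  atEnd n@(suc _) v  _    v∈ = ∈-++⁺ˡ (∈-map⁺ (_▷ n) v∈)
... | x ∷ u , y ∷ v , refl with <-cmp x y
...   | tri< x<y _ _ = contradiction (x<y , y<n) (av σ)
  where
  open Perm₂₃₁ P
  σ : x ∷ n ∷ y ∷ [] ⊆ x ∷ u ++ n ∷ y ∷ v
  σ = refl ∷ ++⁺ˡ u (refl ∷ refl ∷ minimum v)
  y<n = Perm-< isPerm (to∈ (⊆-trans (_ ∷ʳ _ ∷ʳ refl ∷ []) σ)) (Perm-≢ isPerm (⊆-trans (_ ∷ʳ ⊆-refl) σ) ∘ sym)
...   | tri≈ _ refl _ = contradiction refl (Perm-≢ (Perm₂₃₁.isPerm P) (refl ∷ ++⁺ˡ u (_ ∷ʳ refl ∷ minimum v)))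
...   | tri> _ _ y<x = contradiction (y<x , x<n) (av231 σ)
  where
  open Perm₂₃₁ P
  σ : x ∷ n ∷ y ∷ [] ⊆ x ∷ u ++ n ∷ y ∷ v
  σ = refl ∷ ++⁺ˡ u (refl ∷ refl ∷ minimum v)
  x<n = Perm-< isPerm (here refl) (Perm-≢ isPerm (⊆-trans (refl ∷ refl ∷ minimum _) σ))

-- If the first entry `x` is neither 0 nor `n`, both of these come later, and `x 0 n` is a 213 or
-- `x n 0` is a 231.
grow₂₁₃-complete : ∀ n {ws} → (∀ {w} → Perm₂₃₁ ⟨213⟩ n w → w ∈ ws) →
                   ∀ {w} → Perm₂₃₁ ⟨213⟩ (suc n) w → w ∈ grow₂₁₃ n ws
grow₂₁₃-complete n complete {[]} P with () ← length≡ (Perm₂₃₁.isPerm P)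
grow₂₁₃-complete zero complete {x ∷ v} P with All.head (bounded (Perm₂₃₁.isPerm P))
... | s≤s z≤n = ∈-map⁺ (0 ∷_) (complete (Perm₂₃₁-∷⁻ P))
grow₂₁₃-complete n@(suc _) {ws} complete {x ∷ v} P with x ≟ n
... | yes refl = ∈-++⁺ʳ (map (join 0 []) ws) (∈-map⁺ (n ∷_) (complete (Perm₂₃₁-∷⁻ P)))
grow₂₁₃-complete n@(suc _) {ws} complete {zero ∷ v} P@record { isPerm = pm@(perm _ (0∉v ∷ _) _) } | no _
  with R , refl ← unshift 0 v (All.map (λ 0≢y → n≢0⇒n>0 (0≢y ∘ sym)) 0∉v)
  with _ , refl , _ , PR ← Perm-join⁻ [] R pm [] =
  ∈-++⁺ˡ (∈-map⁺ (join 0 []) (complete record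
    { isPerm = PR
    ; av231  = avoids-map⁻ {⟨231⟩} suc (shift-⟨⟩ 1) (avoids-resp-⊆ {⟨231⟩} ⊆-tail av231)
    ; av     = avoids-map⁻ {⟨213⟩} suc (shift-⟨⟩ 1) (avoids-resp-⊆ {⟨213⟩} ⊆-tail av)
    }))
  where open Perm₂₃₁ P using (av231; av)
grow₂₁₃-complete n@(suc _) complete {x@(suc _) ∷ v} P | no x≢n
  with x<n ← Perm-< (Perm₂₃₁.isPerm P) (here refl) x≢n
  with Perm-∈ (Perm₂₃₁.isPerm P) (z<s {n}) | Perm-∈ (Perm₂₃₁.isPerm P) (n<1+n n)
... | here ()   | _
... | _         | here refl = contradiction refl x≢n
... | there 0∈v | there n∈v with ∈-pair 0∈v n∈v (λ ())
...   | inj₁ σ = contradiction (z<s , x<n) (Perm₂₃₁.av P (refl ∷ σ))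
...   | inj₂ σ = contradiction (z<s , x<n) (Perm₂₃₁.av231 P (refl ∷ σ))

words₁₃₂-complete : ∀ n {w} → Perm₂₃₁ ⟨132⟩ n w → w ∈ words₁₃₂ n
words₁₃₂-complete zero    P = here (Perm-0 (Perm₂₃₁.isPerm P))
words₁₃₂-complete (suc n) P = grow₁₃₂-complete n (words₁₃₂-complete n) P

words₂₁₃-complete : ∀ n {w} → Perm₂₃₁ ⟨213⟩ n w → w ∈ words₂₁₃ n
words₂₁₃-complete zero    P = here (Perm-0 (Perm₂₃₁.isPerm P))
words₂₁₃-complete (suc n) P = grow₂₁₃-complete n (words₂₁₃-complete n) P

-- `a` counts the blocks of `mixed s` that precede the block with first entry `s + a`.
mixed-complete : ∀ a {s b L R} → L ∈ words₁₃₂ (s + a) → R ∈ words₂₁₃ (suc b) →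
                 join (s + a) L R ∈ mixed s (a + suc b)
mixed-complete zero    {s} L∈ R∈ rewrite +-identityʳ s =
  ∈-++⁺ˡ (∈-cartesianProductWith⁺ (join s) L∈ R∈)
mixed-complete (suc a) {s} L∈ R∈ rewrite +-suc s a =
  ∈-++⁺ʳ _ (mixed-complete a L∈ R∈)

max-first-complete : ∀ {n j v} → (∀ {w} → Perm₁₃₂₄ n w → w ∈ words₁₃₂₄ n) →
                     Perm₁₃₂₄ (suc n) (j ∷ v) → j ≡ n → j ∷ v ∈ words₁₃₂₄ (suc n)
max-first-complete {n} complete P refl = ∈-++⁺ʳ (mixed 0 n) (∈-map⁺ (n ∷_) (complete record
  { isPerm = Perm-∷⁻ isPerm
  ; av231  = avoids-resp-⊆ {⟨231⟩} ⊆-tail av231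
  ; av1324 = λ σ → av1324 (_ ∷ʳ σ)
  }))
  where open Perm₁₃₂₄ P

-- When `R` is nonempty, an entry of `R` extends any 132 in `L` to a 1324, and `j` extends any 213
-- in `R` to one.
words₁₃₂₄-complete : ∀ n {w} → Perm₁₃₂₄ n w → w ∈ words₁₃₂₄ n
words₁₃₂₄-complete zero             P = here (Perm-0 (Perm₁₃₂₄.isPerm P))
words₁₃₂₄-complete (suc n) {[]}    P with () ← length≡ (Perm₁₃₂₄.isPerm P)
words₁₃₂₄-complete (suc n) {j ∷ v} P@record { isPerm = pm@(perm _ (j∉v ∷ _) _) }
  with L , R⁺ , refl , L<j , j<R ← split-at j v j∉v (λ σ → Perm₁₃₂₄.av231 P (refl ∷ σ))
  with R , refl ← unshift j R⁺ j<R
  with Perm-join⁻ L R pm L<j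
... | zero , j+0≡n , _ , _ =
  max-first-complete (words₁₃₂₄-complete n) P (trans (sym (+-identityʳ j)) j+0≡n)
... | suc b , refl , pL , pR =
  ∈-++⁺ˡ (mixed-complete j (words₁₃₂-complete j PL) (words₂₁₃-complete (suc b) PR))
  where
  open Perm₁₃₂₄ P using (av231; av1324)
  L⊆ : L ⊆ join j L R
  L⊆ = _ ∷ʳ ++⁺ʳ (map (suc j +_) R) ⊆-refl
  R⊆ : map (suc j +_) R ⊆ join j L R
  R⊆ = _ ∷ʳ ++⁺ˡ L ⊆-refl

  -- The least entry of the lifted `R`, present because `R` has length `suc b`, will play the 4.
  r⊆R : [ suc j + 0 ] ⊆ map (suc j +_) R
  r⊆R = from∈ (∈-map⁺ (suc j +_) (Perm-∈ pR z<s))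

  PL : Perm₂₃₁ ⟨132⟩ j L
  PL = record
    { isPerm = pL
    ; av231  = avoids-resp-⊆ {⟨231⟩} L⊆ av231
    ; av     = λ σ (a<c , c<b) → av1324 (_ ∷ʳ ++⁺ σ r⊆R)
        (a<c , c<b , <-≤-trans (All.lookup L<j (to∈ (⊆-trans (_ ∷ʳ refl ∷ minimum _) σ)))
                               (≤-trans (n≤1+n j) (m≤m+n (suc j) 0)))
    }

  PR : Perm₂₃₁ ⟨213⟩ (suc b) R
  PR = record
    { isPerm = pR
    ; av231  = avoids-map⁻ {⟨231⟩} (suc j +_) (shift-⟨⟩ (suc j)) (avoids-resp-⊆ {⟨231⟩} R⊆ av231)
    ; av     = avoids-map⁻ {⟨213⟩} (suc j +_) (shift-⟨⟩ (suc j)) λ σ (b<a , a<c) →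
        av1324 (refl ∷ ++⁺ˡ L σ) (All.lookup j<R (to∈ (⊆-trans (_ ∷ʳ refl ∷ minimum _) σ)) , b<a , a<c)
    }

-- The enumerations have no repetitions.

++-injective : ∀ {X : Set} (xs ys : List X) {us vs} → length xs ≡ length ys →
               xs ++ us ≡ ys ++ vs → xs ≡ ys × us ≡ vs
++-injective []       []       _  eq = refl , eq
++-injective (x ∷ xs) (y ∷ ys) lengths eq
  with refl , eq′ ← ∷-injective eq
  with refl , us≡vs ← ++-injective xs ys (suc-injective lengths) eq′ = refl , us≡vs

-- `L` and `L′` both have length `j`, so the two words are cut at the same place.
join-injective : ∀ {j L L′ R R′} → Perm j L → Perm j L′ → join j L R ≡ join j L′ R′ → L ≡ L′ × R ≡ R′
join-injective {j} {L} {L′} PL PL′ eq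
  with L≡L′ , eq′ ← ++-injective L L′ (trans (length≡ PL) (sym (length≡ PL′))) (∷-injectiveʳ eq) =
  L≡L′ , map-injective (+-cancelˡ-≡ (suc j) _ _) eq′

map-∷-unique : ∀ {x : ℕ} {ws} → Unique ws → Unique (map (x ∷_) ws)
map-∷-unique = Uniqueₚ.map⁺ ∷-injectiveʳ

-- For positive `n` a word `v ▷ n` begins with an entry of the nonempty `v`, hence below `n`, and so
-- differs from every `n ∷ v′`.
grow₁₃₂-unique : ∀ n {ws} → (∀ {w} → w ∈ ws → Perm n w) → Unique ws → Unique (grow₁₃₂ n ws)
grow₁₃₂-unique zero      sound u = map-∷-unique u
grow₁₃₂-unique n@(suc _) {ws} sound u =
  Uniqueₚ.++⁺ (Uniqueₚ.map⁺ (∷ʳ-injectiveˡ _ _) u) (map-∷-unique u) disjoint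
  where
  disjoint : ∀ {w} → ¬ (w ∈ map (_▷ n) ws × w ∈ map (n ∷_) ws)
  disjoint (w∈ʳ , w∈ˡ)
    with v , v∈ , refl ← ∈-map⁻ (_▷ n) w∈ʳ | _ , _ , eq ← ∈-map⁻ (n ∷_) w∈ˡ
    with sound v∈
  ... | perm l _ b with v
  ...   | []     = contradiction l λ ()
  ...   | x ∷ v′ = <⇒≢ (All.head b) (∷-injectiveˡ eq)

grow₂₁₃-unique : ∀ n {ws} → Unique ws → Unique (grow₂₁₃ n ws)
grow₂₁₃-unique zero      u = map-∷-unique u
grow₂₁₃-unique n@(suc _) {ws} u =
  Uniqueₚ.++⁺ (Uniqueₚ.map⁺ (map-injective suc-injective ∘ ∷-injectiveʳ) u) (map-∷-unique u) disjoint
  where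
  disjoint : ∀ {w} → ¬ (w ∈ map (join 0 []) ws × w ∈ map (n ∷_) ws)
  disjoint (w∈ʲ , w∈ˡ)
    with _ , _ , refl ← ∈-map⁻ (join 0 []) w∈ʲ | _ , _ , () ← ∈-map⁻ (n ∷_) w∈ˡ

words₁₃₂-unique : ∀ n → Unique (words₁₃₂ n)
words₁₃₂-unique zero    = [] ∷ []
words₁₃₂-unique (suc n) =
  grow₁₃₂-unique n (Perm₂₃₁.isPerm ∘ words₁₃₂-sound n) (words₁₃₂-unique n)

words₂₁₃-unique : ∀ n → Unique (words₂₁₃ n)
words₂₁₃-unique zero    = [] ∷ []
words₂₁₃-unique (suc n) = grow₂₁₃-unique n (words₂₁₃-unique n)

joins-unique : ∀ {j Ls Rs} → All (Perm j) Ls → Unique Ls → Unique Rs →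
               Unique (cartesianProductWith (join j) Ls Rs)
joins-unique {Ls = []}     _         _         _  = []
joins-unique {j} {L ∷ Ls} {Rs} (PL ∷ PLs) (L∉ ∷ uL) uR =
  Uniqueₚ.++⁺ (Uniqueₚ.map⁺ (proj₂ ∘ join-injective PL PL) uR) (joins-unique PLs uL uR) disjoint
  where
  disjoint : ∀ {w} → ¬ (w ∈ map (join j L) Rs × w ∈ cartesianProductWith (join j) Ls Rs)
  disjoint (w∈ , w∈′)
    with _ , _ , refl ← ∈-map⁻ (join j L) w∈
       | L′ , _ , L′∈ , _ , eq ← ∈-cartesianProductWith⁻ (join j) Ls Rs w∈′ =
    All.lookup L∉ L′∈ (proj₁ (join-injective PL (All.lookup PLs L′∈) eq))

-- First entries tell the blocks of `mixed` apart, and tell them from the words that begin with the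
-- maximum.
mixed-head : ∀ s m {w} → w ∈ mixed s m → ∃₂ λ j v → w ≡ j ∷ v × s ≤ j × j < s + m
mixed-head s (suc m) w∈
  with ∈-++⁻ (cartesianProductWith (join s) (words₁₃₂ s) (words₂₁₃ (suc m))) w∈
... | inj₁ w∈′ with _ , _ , _ , _ , refl ← ∈-cartesianProductWith⁻ (join s) (words₁₃₂ s) (words₂₁₃ (suc m)) w∈′ =
  s , _ , refl , ≤-refl , m<m+n s z<s
... | inj₂ w∈′ with j , v , eq , s<j , j< ← mixed-head (suc s) m w∈′ =
  j , v , eq , <⇒≤ s<j , <-≤-trans j< (≤-reflexive (sym (+-suc s m)))

mixed-unique : ∀ s m → Unique (mixed s m)
mixed-unique s zero    = []
mixed-unique s (suc m) = Uniqueₚ.++⁺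
  (joins-unique (All.tabulate (Perm₂₃₁.isPerm ∘ words₁₃₂-sound s)) (words₁₃₂-unique s) (words₂₁₃-unique (suc m)))
  (mixed-unique (suc s) m)
  disjoint
  where
  disjoint : ∀ {w} → ¬ (w ∈ cartesianProductWith (join s) (words₁₃₂ s) (words₂₁₃ (suc m)) × w ∈ mixed (suc s) m)
  disjoint (w∈ , w∈′)
    with _ , _ , _ , _ , refl ← ∈-cartesianProductWith⁻ (join s) (words₁₃₂ s) (words₂₁₃ (suc m)) w∈
       | _ , _ , refl , 1+s≤s , _ ← mixed-head (suc s) m w∈′ = n≮n s 1+s≤s

words₁₃₂₄-unique : ∀ n → Unique (words₁₃₂₄ n)
words₁₃₂₄-unique zero    = [] ∷ []
words₁₃₂₄-unique (suc n) = Uniqueₚ.++⁺ (mixed-unique 0 n) (map-∷-unique (words₁₃₂₄-unique n)) disjoint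
  where
  disjoint : ∀ {w} → ¬ (w ∈ mixed 0 n × w ∈ map (n ∷_) (words₁₃₂₄ n))
  disjoint (w∈ , w∈′)
    with _ , _ , refl , _ , j<n ← mixed-head 0 n w∈ | _ , _ , refl ← ∈-map⁻ (n ∷_) w∈′ = n≮n n j<n

-- Counting inversions

length-filter-map : ∀ {X Y : Set} {P : Pred Y 0ℓ} (P? : Decidable P) (f : X → Y) xs →
                    length (filter P? (map f xs)) ≡ length (filter (P? ∘ f) xs)
length-filter-map P? f []       = refl
length-filter-map P? f (x ∷ xs) with P? (f x)
... | yes _ = cong suc (length-filter-map P? f xs)
... | no  _ = length-filter-map P? f xs

length-filter-++ : ∀ {X : Set} {P : Pred X 0ℓ} (P? : Decidable P) xs ys →
                   length (filter P? (xs ++ ys)) ≡ length (filter P? xs) + length (filter P? ys)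
length-filter-++ P? xs ys = trans (cong length (filter-++ P? xs ys)) (length-++ (filter P? xs))

length-filter-≐ : ∀ {X : Set} {P Q : Pred X 0ℓ} (P? : Decidable P) (Q? : Decidable Q) → P ≐ Q → ∀ xs →
                  length (filter P? xs) ≡ length (filter Q? xs)
length-filter-≐ P? Q? P≐Q xs = cong length (filter-≐ P? Q? P≐Q xs)

inversions : Word → ℕ
inversions []      = 0
inversions (x ∷ w) = length (filter (_<? x) w) + inversions w

length-filter-< : ∀ {x w} → All (_< x) w → length (filter (_<? x) w) ≡ length w
length-filter-< w<x = cong length (filter-all (_<? _) w<x)

filter-<-++ : ∀ {x} v {w} → All (x ≤_) w → filter (_<? x) (v ++ w) ≡ filter (_<? x) v
filter-<-++ {x} v {w} x≤w = begin
  filter (_<? x) (v ++ w)                   ≡⟨ filter-++ (_<? x) v w ⟩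
  filter (_<? x) v ++ filter (_<? x) w      ≡⟨ cong (filter (_<? x) v ++_) (filter-none (_<? x) (All.map ≤⇒≯ x≤w)) ⟩
  filter (_<? x) v ++ []                    ≡⟨ ++-identityʳ _ ⟩
  filter (_<? x) v                          ∎
  where open ≡-Reasoning

inversions-++ : ∀ {j v w} → All (_< j) v → All (j ≤_) w → inversions (v ++ w) ≡ inversions v + inversions w
inversions-++ {v = []}    _           _   = refl
inversions-++ {v = x ∷ v} {w} (x<j ∷ v<j) j≤w = begin
  length (filter (_<? x) (v ++ w)) + inversions (v ++ w)
    ≡⟨ cong₂ _+_ (cong length (filter-<-++ v (All.map (≤-trans (<⇒≤ x<j)) j≤w))) (inversions-++ v<j j≤w) ⟩
  length (filter (_<? x) v) + (inversions v + inversions w)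
    ≡⟨ +-assoc (length (filter (_<? x) v)) _ _ ⟨
  length (filter (_<? x) v) + inversions v + inversions w ∎
  where open ≡-Reasoning

inversions-max : ∀ {n w} → Perm n w → inversions (n ∷ w) ≡ n + inversions w
inversions-max p = cong (_+ _) (trans (length-filter-< (bounded p)) (length≡ p))

inversions-∷ʳ : ∀ {n w} → Perm n w → inversions (w ▷ n) ≡ inversions w
inversions-∷ʳ p = trans (inversions-++ (bounded p) (≤-refl ∷ [])) (+-identityʳ _)

inversions-map : ∀ k w → inversions (map (k +_) w) ≡ inversions w
inversions-map k []      = refl
inversions-map k (x ∷ w) = cong₂ _+_ (smaller w) (inversions-map k w)
  where
  smaller : ∀ w → length (filter (_<? k + x) (map (k +_) w)) ≡ length (filter (_<? x) w)
  smaller []      = refl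
  smaller (y ∷ w) with <-≤-connex y x
  ... | inj₁ y<x = begin
    length (filter (_<? k + x) (k + y ∷ map (k +_) w))    ≡⟨ cong length (filter-accept (_<? k + x) (+-monoʳ-< k y<x)) ⟩
    suc (length (filter (_<? k + x) (map (k +_) w)))      ≡⟨ cong suc (smaller w) ⟩
    suc (length (filter (_<? x) w))                       ≡⟨ cong length (filter-accept (_<? x) y<x) ⟨
    length (filter (_<? x) (y ∷ w))                       ∎
    where open ≡-Reasoning
  ... | inj₂ x≤y = begin
    length (filter (_<? k + x) (k + y ∷ map (k +_) w))    ≡⟨ cong length (filter-reject (_<? k + x) (≤⇒≯ (+-monoʳ-≤ k x≤y))) ⟩
    length (filter (_<? k + x) (map (k +_) w))            ≡⟨ smaller w ⟩
    length (filter (_<? x) w)                             ≡⟨ cong length (filter-reject (_<? x) (≤⇒≯ x≤y)) ⟨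
    length (filter (_<? x) (y ∷ w))                       ∎
    where open ≡-Reasoning

-- The leading `j` exceeds precisely the `j` entries of `L`, and no inversion runs from `L` to the
-- lifted `R`.
inversions-join : ∀ {j L} → Perm j L → ∀ R → inversions (join j L R) ≡ j + (inversions L + inversions R)
inversions-join {j} {L} PL R = cong₂ _+_
  (trans (cong length (filter-<-++ L j≤R)) (trans (length-filter-< (bounded PL)) (length≡ PL)))
  (trans (inversions-++ (bounded PL) j≤R) (cong (inversions L +_) (inversions-map (suc j) R)))
  where
  j≤R : All (j ≤_) (map (suc j +_) R)
  j≤R = Allₚ.map⁺ (All.universal (λ x → ≤-trans (n≤1+n j) (m≤m+n (suc j) x)) R)

-- Generating functions

-- The polynomial Σ q^e over the entries `e` of the list.
coeff : List ℕ → Poly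
coeff es k = length (filter (_≟ k) es)

coeff-++ : ∀ es fs → coeff (es ++ fs) ≗ coeff es ⊕ coeff fs
coeff-++ es fs k = length-filter-++ (_≟ k) es fs

coeff-suc : ∀ es → coeff (map suc es) ≗ q (coeff es)
coeff-suc []       zero    = refl
coeff-suc []       (suc k) = refl
coeff-suc (e ∷ es) zero    = coeff-suc es zero
-- `_≟_` computes through `_≡ᵇ_`, and `suc e ≡ᵇ suc k` reduces to `e ≡ᵇ k`, so one split decides
-- both filters.
coeff-suc (e ∷ es) (suc k) with e ≡ᵇ k
... | true  = cong suc (coeff-suc es (suc k))
... | false = coeff-suc es (suc k)

coeff-+ : ∀ n es → coeff (map (n +_) es) ≗ q^ n (coeff es)
coeff-+ zero    es k = cong (λ fs → coeff fs k) (map-id es)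
coeff-+ (suc n) es k = begin
  coeff (map (suc n +_) es) k           ≡⟨ cong (λ fs → coeff fs k) (map-∘ es) ⟩
  coeff (map suc (map (n +_) es)) k     ≡⟨ coeff-suc (map (n +_) es) k ⟩
  q (coeff (map (n +_) es)) k           ≡⟨ q-cong (coeff-+ n es) k ⟩
  q (q^ n (coeff es)) k                 ∎
  where open ≡-Reasoning

infixl 6 _⊞_

-- Multiplication of polynomials given by their lists of exponents.
_⊞_ : List ℕ → List ℕ → List ℕ
_⊞_ = cartesianProductWith _+_

map-+-⊞ : ∀ n es fs → map (n +_) es ⊞ fs ≡ map (n +_) (es ⊞ fs)
map-+-⊞ n []       fs = refl
map-+-⊞ n (e ∷ es) fs = begin
  map (n + e +_) fs ++ (map (n +_) es ⊞ fs)
    ≡⟨ cong₂ _++_ (trans (map-cong (+-assoc n e) fs) (map-∘ fs)) (map-+-⊞ n es fs) ⟩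
  map (n +_) (map (e +_) fs) ++ map (n +_) (es ⊞ fs)
    ≡⟨ map-++ (n +_) (map (e +_) fs) (es ⊞ fs) ⟨
  map (n +_) (map (e +_) fs ++ (es ⊞ fs)) ∎
  where open ≡-Reasoning

-- The exponents of D_n expanded, in the order in which `grow₁₃₂` and `grow₂₁₃` produce words. The
-- inversion numbers of both enumerations thus agree with it as lists.
exponents : ℕ → List ℕ
exponents zero            = [ 0 ]
exponents (suc zero)      = [ 0 ]
exponents (suc n@(suc _)) = exponents n ++ map (n +_) (exponents n)

-- `⊞` distributes over the two halves of `exponents`, and the shifted half contributes the summand
-- `q^ a` of `mulD`.
coeff-exponents-⊞ : ∀ a es → coeff (exponents a ⊞ es) ≗ mulD a (coeff es)
coeff-exponents-⊞ zero       es k = cong (λ fs → coeff fs k) (trans (++-identityʳ _) (map-id es))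
coeff-exponents-⊞ (suc zero) es k = cong (λ fs → coeff fs k) (trans (++-identityʳ _) (map-id es))
coeff-exponents-⊞ (suc a@(suc _)) es k = begin
  coeff ((E ++ map (a +_) E) ⊞ es) k
    ≡⟨ cong (λ fs → coeff fs k) (cartesianProductWith-distribʳ-++ _+_ E (map (a +_) E) es) ⟩
  coeff ((E ⊞ es) ++ (map (a +_) E ⊞ es)) k
    ≡⟨ coeff-++ (E ⊞ es) _ k ⟩
  (coeff (E ⊞ es) ⊕ coeff (map (a +_) E ⊞ es)) k
    ≡⟨ cong (λ fs → (coeff (E ⊞ es) ⊕ coeff fs) k) (map-+-⊞ a E es) ⟩
  (coeff (E ⊞ es) ⊕ coeff (map (a +_) (E ⊞ es))) k
    ≡⟨ ⊕-congˡ (coeff (E ⊞ es)) (coeff-+ a (E ⊞ es)) k ⟩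
  (coeff (E ⊞ es) ⊕ q^ a (coeff (E ⊞ es))) k
    ≡⟨ ⊕-cong (coeff-exponents-⊞ a es) (q^-cong a (coeff-exponents-⊞ a es)) k ⟩
  mulD (suc a) (coeff es) k ∎
  where
  open ≡-Reasoning
  E = exponents a

coeff-[0] : coeff [ 0 ] ≗ 𝟙
coeff-[0] zero    = refl
coeff-[0] (suc k) = refl

coeff-exponents : ∀ b → coeff (exponents b) ≗ D b
coeff-exponents b k = begin
  coeff (exponents b) k              ≡⟨ cong (λ fs → coeff fs k) (⊞-[0] (exponents b)) ⟨
  coeff (exponents b ⊞ [ 0 ]) k      ≡⟨ coeff-exponents-⊞ b [ 0 ] k ⟩
  mulD b (coeff [ 0 ]) k             ≡⟨ mulD-cong b coeff-[0] k ⟩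
  D b k                              ∎
  where
  open ≡-Reasoning
  ⊞-[0] : ∀ es → es ⊞ [ 0 ] ≡ es
  ⊞-[0] []       = refl
  ⊞-[0] (e ∷ es) = cong₂ _∷_ (+-identityʳ e) (⊞-[0] es)

map-inversions : ∀ {f : Word → Word} {g : ℕ → ℕ} {ws} → (∀ {w} → w ∈ ws → inversions (f w) ≡ g (inversions w)) →
                 map inversions (map f ws) ≡ map g (map inversions ws)
map-inversions {f} {g} {ws} eq = begin
  map inversions (map f ws)        ≡⟨ map-∘ ws ⟨
  map (inversions ∘ f) ws          ≡⟨ map-cong-local (All.tabulate eq) ⟩
  map (g ∘ inversions) ws          ≡⟨ map-∘ ws ⟩
  map g (map inversions ws)        ∎
  where open ≡-Reasoning

-- Serves both classes: `f` is the insertion that creates no inversion, a last maximum or a first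
-- minimum.
inversions-grow : ∀ {n f ws es} → (∀ {w} → w ∈ ws → Perm n w) →
                  (∀ {w} → Perm n w → inversions (f w) ≡ inversions w) →
                  map inversions ws ≡ es →
                  map inversions (map f ws ++ map (n ∷_) ws) ≡ es ++ map (n +_) es
inversions-grow {n} {f} {ws} sound inv-f refl = begin
  map inversions (map f ws ++ map (n ∷_) ws)
    ≡⟨ map-++ inversions (map f ws) _ ⟩
  map inversions (map f ws) ++ map inversions (map (n ∷_) ws)
    ≡⟨ cong₂ _++_ (trans (map-inversions (inv-f ∘ sound)) (map-id _)) (map-inversions (inversions-max ∘ sound)) ⟩
  map inversions ws ++ map (n +_) (map inversions ws) ∎
  where open ≡-Reasoning

words₁₃₂-inversions : ∀ n → map inversions (words₁₃₂ n) ≡ exponents n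
words₁₃₂-inversions zero            = refl
words₁₃₂-inversions (suc zero)      = refl
words₁₃₂-inversions (suc n@(suc _)) =
  inversions-grow (Perm₂₃₁.isPerm ∘ words₁₃₂-sound n) inversions-∷ʳ (words₁₃₂-inversions n)

words₂₁₃-inversions : ∀ n → map inversions (words₂₁₃ n) ≡ exponents n
words₂₁₃-inversions zero            = refl
words₂₁₃-inversions (suc zero)      = refl
words₂₁₃-inversions (suc n@(suc _)) =
  inversions-grow (Perm₂₃₁.isPerm ∘ words₂₁₃-sound n) (λ {w} _ → inversions-join (perm refl [] []) w) (words₂₁₃-inversions n)

joins-inversions : ∀ {j Ls Rs} → All (Perm j) Ls →
  map inversions (cartesianProductWith (join j) Ls Rs) ≡ map (j +_) (map inversions Ls ⊞ map inversions Rs)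
joins-inversions {Ls = []} _ = refl
joins-inversions {j} {L ∷ Ls} {Rs} (PL ∷ PLs) = begin
  map inversions (map (join j L) Rs ++ cartesianProductWith (join j) Ls Rs)
    ≡⟨ map-++ inversions (map (join j L) Rs) _ ⟩
  map inversions (map (join j L) Rs) ++ map inversions (cartesianProductWith (join j) Ls Rs)
    ≡⟨ cong₂ _++_ (trans (map-inversions (λ {R} _ → inversions-join PL R)) (map-∘ _)) (joins-inversions PLs) ⟩
  map (j +_) (map (inversions L +_) (map inversions Rs)) ++ map (j +_) (map inversions Ls ⊞ map inversions Rs)
    ≡⟨ map-++ (j +_) (map (inversions L +_) (map inversions Rs)) _ ⟨
  map (j +_) (map inversions (L ∷ Ls) ⊞ map inversions Rs) ∎
  where open ≡-Reasoning

joins-coeff : ∀ j b → coeff (map inversions (cartesianProductWith (join j) (words₁₃₂ j) (words₂₁₃ b))) ≗ T j b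
joins-coeff j b k = begin
  coeff (map inversions (cartesianProductWith (join j) (words₁₃₂ j) (words₂₁₃ b))) k
    ≡⟨ cong (λ es → coeff es k) (joins-inversions (All.tabulate (Perm₂₃₁.isPerm ∘ words₁₃₂-sound j))) ⟩
  coeff (map (j +_) (map inversions (words₁₃₂ j) ⊞ map inversions (words₂₁₃ b))) k
    ≡⟨ cong₂ (λ es fs → coeff (map (j +_) (es ⊞ fs)) k) (words₁₃₂-inversions j) (words₂₁₃-inversions b) ⟩
  coeff (map (j +_) (exponents j ⊞ exponents b)) k
    ≡⟨ coeff-+ j (exponents j ⊞ exponents b) k ⟩
  q^ j (coeff (exponents j ⊞ exponents b)) k
    ≡⟨ q^-cong j (coeff-exponents-⊞ j (exponents b)) k ⟩
  q^ j (mulD j (coeff (exponents b))) k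
    ≡⟨ q^-cong j (mulD-cong j (coeff-exponents b)) k ⟩
  T j b k ∎
  where open ≡-Reasoning

mixed-coeff : ∀ s m → coeff (map inversions (mixed s m)) ≗ conv (λ a b → T (s + a) b) m
mixed-coeff s zero    k = refl
mixed-coeff s (suc m) k = begin
  coeff (map inversions (joins ++ mixed (suc s) m)) k
    ≡⟨ cong (λ es → coeff es k) (map-++ inversions joins (mixed (suc s) m)) ⟩
  coeff (map inversions joins ++ map inversions (mixed (suc s) m)) k
    ≡⟨ coeff-++ (map inversions joins) _ k ⟩
  coeff (map inversions joins) k + coeff (map inversions (mixed (suc s) m)) k
    ≡⟨ cong₂ _+_ (joins-coeff s (suc m) k) (mixed-coeff (suc s) m k) ⟩
  T s (suc m) k + conv (λ a b → T (suc s + a) b) m k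
    ≡⟨ cong₂ _+_ (cong (λ j → T j (suc m) k) (sym (+-identityʳ s))) (conv-cong m (λ a b → cong (λ j → T j b) (sym (+-suc s a))) k) ⟩
  T (s + 0) (suc m) k + conv (λ a b → T (s + suc a) b) m k ∎
  where
  open ≡-Reasoning
  joins = cartesianProductWith (join s) (words₁₃₂ s) (words₂₁₃ (suc m))
  conv-cong : ∀ m {f g} → (∀ a b → f a b ≡ g a b) → conv f m ≗ conv g m
  conv-cong zero    eq k = refl
  conv-cong (suc m) eq k = cong₂ _+_ (cong (λ P → P k) (eq 0 (suc m))) (conv-cong m (λ a b → eq (suc a) b) k)

words₁₃₂₄-coeff : ∀ n → coeff (map inversions (words₁₃₂₄ n)) ≗ A n
words₁₃₂₄-coeff zero    = coeff-[0]
words₁₃₂₄-coeff (suc n) k = begin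
  coeff (map inversions (mixed 0 n ++ map (n ∷_) (words₁₃₂₄ n))) k
    ≡⟨ cong (λ es → coeff es k) (map-++ inversions (mixed 0 n) _) ⟩
  coeff (map inversions (mixed 0 n) ++ map inversions (map (n ∷_) (words₁₃₂₄ n))) k
    ≡⟨ coeff-++ (map inversions (mixed 0 n)) _ k ⟩
  coeff (map inversions (mixed 0 n)) k + coeff (map inversions (map (n ∷_) (words₁₃₂₄ n))) k
    ≡⟨ cong₂ _+_ (mixed-coeff 0 n k) (cong (λ es → coeff es k) (map-inversions (inversions-max ∘ Perm₁₃₂₄.isPerm ∘ words₁₃₂₄-sound n))) ⟩
  U n k + coeff (map (n +_) (map inversions (words₁₃₂₄ n))) k
    ≡⟨ cong (U n k +_) (trans (coeff-+ n (map inversions (words₁₃₂₄ n)) k) (q^-cong n (words₁₃₂₄-coeff n) k)) ⟩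
  A (suc n) k ∎
  where open ≡-Reasoning

-- One-line notation

oneLine : ∀ {n} → Permutation′ n → Word
oneLine π = tabulate (toℕ ∘ (π ⟨$⟩ʳ_))

⟨$⟩ʳ-injective : ∀ {n} (π : Permutation′ n) {i j} → π ⟨$⟩ʳ i ≡ π ⟨$⟩ʳ j → i ≡ j
⟨$⟩ʳ-injective π eq = trans (sym (P.inverseˡ π)) (trans (cong (π ⟨$⟩ˡ_) eq) (P.inverseˡ π))

oneLine-Perm : ∀ {n} (π : Permutation′ n) → Perm n (oneLine π)
oneLine-Perm π = perm (length-tabulate (toℕ ∘ (π ⟨$⟩ʳ_)))
  (Uniqueₚ.tabulate⁺ (⟨$⟩ʳ-injective π ∘ toℕ-injective))
  (Allₚ.tabulate⁺ (λ i → toℕ<n (π ⟨$⟩ʳ i)))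

tabulate-injective : ∀ {X : Set} {n} {f g : Fin n → X} → tabulate f ≡ tabulate g → f ≗ g
tabulate-injective eq zero    = ∷-injectiveˡ eq
tabulate-injective eq (suc i) = tabulate-injective (∷-injectiveʳ eq) i

oneLine-injective : ∀ {n} {π ρ : Permutation′ n} → oneLine π ≡ oneLine ρ → π ≈ ρ
oneLine-injective eq i = toℕ-injective (tabulate-injective eq i)

-- The inverse sends a value to the position at which `Perm-∈` finds it.
oneLine-surjective : ∀ {n w} → Perm n w → ∃[ π ] oneLine {n} π ≡ w
oneLine-surjective {w = w} p@(perm refl u b) =
  permutation to from to-from from-to ,
  trans (tabulate-cong toℕ-to) (tabulate-lookup w)
  where
  lookup< : ∀ i → lookup w i < length w
  lookup< i = All.lookup b (∈-lookup i)

  to from : Fin (length w) → Fin (length w)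
  to i   = fromℕ< (lookup< i)
  from y = Any.index (Perm-∈ p (toℕ<n y))

  toℕ-to : ∀ i → toℕ (to i) ≡ lookup w i
  toℕ-to i = toℕ-fromℕ< (lookup< i)

  to-from : ∀ y → to (from y) ≡ y
  to-from y = toℕ-injective (trans (toℕ-to (from y)) (sym (lookup-index (Perm-∈ p (toℕ<n y)))))

  from-to : ∀ i → from (to i) ≡ i
  from-to i = lookup-injective u (trans (sym (toℕ-to (from (to i)))) (trans (cong toℕ (to-from (to i))) (toℕ-to i)))

-- Arbitrary functions replace permutations here because dropping the first entry of a permutation
-- does not leave a permutation, and the count goes by induction on the length.
InversionAt : ∀ {n} → (Fin n → ℕ) → Pred (Fin n × Fin n) 0ℓ
InversionAt g (i , j) = i Fin.< j × g j < g i

inversionAt? : ∀ {n} (g : Fin n → ℕ) → Decidable (InversionAt g)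
inversionAt? g (i , j) = i Finₚ.<? j ×-dec g j <? g i

-- A pair `(suc i , zero)` is never an inversion and is filtered out by computation; in all other
-- pairs both positions drop by one.
inversions-pairs-suc : ∀ {n} (g : Fin (suc n) → ℕ) is js →
  length (filter (inversionAt? g) (cartesianProduct (map suc is) (zero ∷ map suc js))) ≡
  length (filter (inversionAt? (g ∘ suc)) (cartesianProduct is js))
inversions-pairs-suc g []       js = refl
inversions-pairs-suc g (i ∷ is) js = begin
  # (map (suc i ,_) (map suc js) ++ cartesianProduct (map suc is) (zero ∷ map suc js))
    ≡⟨ length-filter-++ (inversionAt? g) (map (suc i ,_) (map suc js)) _ ⟩
  # (map (suc i ,_) (map suc js)) + # (cartesianProduct (map suc is) (zero ∷ map suc js))
    ≡⟨ cong₂ _+_ row (inversions-pairs-suc g is js) ⟩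
  #′ (map (i ,_) js) + #′ (cartesianProduct is js)
    ≡⟨ length-filter-++ (inversionAt? (g ∘ suc)) (map (i ,_) js) _ ⟨
  #′ (cartesianProduct (i ∷ is) js) ∎
  where
  open ≡-Reasoning
  #  = λ xs → length (filter (inversionAt? g) xs)
  #′ = λ xs → length (filter (inversionAt? (g ∘ suc)) xs)
  row : # (map (suc i ,_) (map suc js)) ≡ #′ (map (i ,_) js)
  row = begin
    # (map (suc i ,_) (map suc js))
      ≡⟨ cong # (map-∘ js) ⟨
    # (map (λ j → suc i , suc j) js)
      ≡⟨ length-filter-map (inversionAt? g) _ js ⟩
    length (filter (inversionAt? g ∘ (λ j → suc i , suc j)) js)
      ≡⟨ length-filter-≐ _ _ ((λ (i<j , r) → s<s⁻¹ i<j , r) , (λ (i<j , r) → s<s i<j , r)) js ⟩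
    length (filter (inversionAt? (g ∘ suc) ∘ (i ,_)) js)
      ≡⟨ length-filter-map (inversionAt? (g ∘ suc)) (i ,_) js ⟨
    #′ (map (i ,_) js) ∎

inversions-tabulate : ∀ {n} (g : Fin n → ℕ) →
  length (filter (inversionAt? g) (cartesianProduct (allFin n) (allFin n))) ≡ inversions (tabulate g)
inversions-tabulate {zero}  g = refl
inversions-tabulate {suc n} g = begin
  # (cartesianProduct (allFin (suc n)) (allFin (suc n)))
    ≡⟨ cong (λ is → # (cartesianProduct (zero ∷ is) (zero ∷ is))) (map-tabulate id suc) ⟨
  # (map (zero ,_) (map suc (allFin n)) ++ cartesianProduct (map suc (allFin n)) (zero ∷ map suc (allFin n)))
    ≡⟨ length-filter-++ (inversionAt? g) (map (zero ,_) (map suc (allFin n))) _ ⟩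
  # (map (zero ,_) (map suc (allFin n))) + # (cartesianProduct (map suc (allFin n)) (zero ∷ map suc (allFin n)))
    ≡⟨ cong₂ _+_ row (trans (inversions-pairs-suc g (allFin n) (allFin n)) (inversions-tabulate (g ∘ suc))) ⟩
  inversions (tabulate g) ∎
  where
  open ≡-Reasoning
  # = λ xs → length (filter (inversionAt? g) xs)
  row : # (map (zero ,_) (map suc (allFin n))) ≡ length (filter (_<? g zero) (tabulate (g ∘ suc)))
  row = begin
    # (map (zero ,_) (map suc (allFin n)))
      ≡⟨ cong # (map-∘ (allFin n)) ⟨
    # (map (λ j → zero , suc j) (allFin n))
      ≡⟨ length-filter-map (inversionAt? g) _ (allFin n) ⟩
    length (filter (inversionAt? g ∘ (λ j → zero , suc j)) (allFin n))
      ≡⟨ length-filter-≐ _ _ (proj₂ , (z<s ,_)) (allFin n) ⟩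
    length (filter ((_<? g zero) ∘ g ∘ suc) (allFin n))
      ≡⟨ length-filter-map (_<? g zero) (g ∘ suc) (allFin n) ⟨
    length (filter (_<? g zero) (map (g ∘ suc) (allFin n)))
      ≡⟨ cong (length ∘ filter (_<? g zero)) (map-tabulate id (g ∘ suc)) ⟩
    length (filter (_<? g zero) (tabulate (g ∘ suc))) ∎

inversions-oneLine : ∀ {n} (π : Permutation′ n) → inversions (oneLine π) ≡ inv π
inversions-oneLine {n} π = trans (sym (inversions-tabulate g))
  (length-filter-≐ (inversionAt? g) (inversion? π) (id , id) (cartesianProduct (allFin n) (allFin n)))
  where g = toℕ ∘ (π ⟨$⟩ʳ_)

-- Pattern occurrences as sublists of the one-line notation.

tabulate-⊆⁺ : ∀ {n} (g : Fin n → ℕ) is → AllPairs Fin._<_ is → map g is ⊆ tabulate g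
tabulate-⊆⁺ g []       _ = minimum (tabulate g)
tabulate-⊆⁺ {suc n} g (i ∷ is) (i<is ∷ ap) = cons i i<is
  where
  sucs : ∀ is → All (zero {n} Fin.<_) is → ∃[ js ] is ≡ map (suc {n}) js
  sucs []           []       = [] , refl
  sucs (suc j ∷ is) (_ ∷ ps) with js , refl ← sucs is ps = j ∷ js , refl

  rest : ∀ is → All (zero {n} Fin.<_) is → AllPairs Fin._<_ is → map g is ⊆ tabulate (g ∘ suc)
  rest is ps ap with js , refl ← sucs is ps = subst (_⊆ tabulate (g ∘ suc)) (map-∘ js)
    (tabulate-⊆⁺ (g ∘ suc) js (AllPairs.map s<s⁻¹ (AllPairsₚ.map⁻ ap)))

  cons : ∀ i → All (i Fin.<_) is → map g (i ∷ is) ⊆ tabulate g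
  cons zero    i<is = refl ∷ rest is i<is ap
  cons (suc i) i<is = g zero ∷ʳ rest (suc i ∷ is) (z<s ∷ All.map (<-trans z<s) i<is) (i<is ∷ ap)

tabulate-⊆⁻ : ∀ {n} (g : Fin n → ℕ) {xs} → xs ⊆ tabulate g → ∃[ is ] AllPairs Fin._<_ is × xs ≡ map g is
tabulate-⊆⁻ {zero}  g []         = [] , [] , refl
tabulate-⊆⁻ {suc n} g (_ ∷ʳ σ)   with js , ap , refl ← tabulate-⊆⁻ (g ∘ suc) σ =
  map suc js , AllPairsₚ.map⁺ (AllPairs.map s<s ap) , map-∘ js
tabulate-⊆⁻ {suc n} g (refl ∷ σ) with js , ap , refl ← tabulate-⊆⁻ (g ∘ suc) σ =
  zero ∷ map suc js , Allₚ.map⁺ (All.universal (λ _ → z<s) js) ∷ AllPairsₚ.map⁺ (AllPairs.map s<s ap) ,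
  cong (g zero ∷_) (map-∘ js)

strictlyIncreasing₃ : (g : Fin 3 → ℕ) → g 0F < g 1F → g 1F < g 2F → ∀ i j → i Fin.< j → g i < g j
strictlyIncreasing₃ g p q 0F 1F _ = p
strictlyIncreasing₃ g p q 0F 2F _ = <-trans p q
strictlyIncreasing₃ g p q 1F 2F _ = q
strictlyIncreasing₃ g p q 1F 1F (s<s ())
strictlyIncreasing₃ g p q 2F 1F (s<s ())
strictlyIncreasing₃ g p q 2F 2F (s<s (s<s ()))

strictlyIncreasing₄ : (g : Fin 4 → ℕ) → g 0F < g 1F → g 1F < g 2F → g 2F < g 3F → ∀ i j → i Fin.< j → g i < g j
strictlyIncreasing₄ g p q r 0F      1F      _         = p
strictlyIncreasing₄ g p q r 0F      (suc (suc j)) _   = <-trans p (strictlyIncreasing₃ (g ∘ suc) q r 0F (suc j) z<s)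
strictlyIncreasing₄ g p q r (suc i) (suc j) (s<s i<j) = strictlyIncreasing₃ (g ∘ suc) q r i j i<j

-- The hypothesis runs through the chosen positions in the order of their pattern values. That gives
-- one direction; the converse follows by trichotomy, as `p` is injective.
orderIsomorphicAt : ∀ {m n} (p : Permutation′ m) (π : Permutation′ n) (f : Fin m → Fin n) →
  (∀ u v → u Fin.< v → π ⟨$⟩ʳ f (p ⟨$⟩ˡ u) Fin.< π ⟨$⟩ʳ f (p ⟨$⟩ˡ v)) → OrderIsomorphicAt p π f
orderIsomorphicAt p π f increasing i j = mk⇔ to from
  where
  to : ∀ {i j} → p ⟨$⟩ʳ i Fin.< p ⟨$⟩ʳ j → π ⟨$⟩ʳ f i Fin.< π ⟨$⟩ʳ f j
  to {i} {j} lt = subst₂ (λ i j → π ⟨$⟩ʳ f i Fin.< π ⟨$⟩ʳ f j) (P.inverseˡ p) (P.inverseˡ p) (increasing _ _ lt)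

  from : π ⟨$⟩ʳ f i Fin.< π ⟨$⟩ʳ f j → p ⟨$⟩ʳ i Fin.< p ⟨$⟩ʳ j
  from lt with Finₚ.<-cmp (p ⟨$⟩ʳ i) (p ⟨$⟩ʳ j)
  ... | tri< p< _ _ = p<
  ... | tri≈ _ p≡ _ with refl ← ⟨$⟩ʳ-injective p p≡ = contradiction lt (n≮n _)
  ... | tri> _ _ p> = contradiction lt (<-asym (to p>))

module _ {n} (π : Permutation′ n) where

  contains231⁺ : ∀ {a b c} → a ∷ b ∷ c ∷ [] ⊆ oneLine π → ⟨231⟩ a b c → Contains p231 π
  contains231⁺ σ (c<a , a<b) with tabulate-⊆⁻ _ σ
  ... | i ∷ j ∷ k ∷ [] , (i<j ∷ _ ∷ []) ∷ (j<k ∷ []) ∷ _ , refl =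
    f , strictlyIncreasing₃ (toℕ ∘ f) i<j j<k ,
    orderIsomorphicAt p231 π f (strictlyIncreasing₃ (λ u → toℕ (π ⟨$⟩ʳ f (p231 ⟨$⟩ˡ u))) c<a a<b)
    where
    f : Fin 3 → Fin n
    f 0F = i
    f 1F = j
    f 2F = k

  contains231⁻ : Contains p231 π → ¬ oneLine π avoids ⟨231⟩
  contains231⁻ (f , inc , iso) av =
    av (tabulate-⊆⁺ _ (f 0F ∷ f 1F ∷ f 2F ∷ [])
         ((inc 0F 1F z<s ∷ inc 0F 2F z<s ∷ []) ∷ (inc 1F 2F (s<s z<s) ∷ []) ∷ [] ∷ []))
       (Equivalence.to (iso 2F 0F) z<s , Equivalence.to (iso 0F 1F) (s<s z<s))

  contains1324⁺ : ∀ {a b c d} → a ∷ b ∷ c ∷ d ∷ [] ⊆ oneLine π → a < c × c < b × b < d → Contains p1324 π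
  contains1324⁺ σ (a<c , c<b , b<d) with tabulate-⊆⁻ _ σ
  ... | i ∷ j ∷ k ∷ l ∷ [] , (i<j ∷ _) ∷ (j<k ∷ _) ∷ (k<l ∷ []) ∷ _ , refl =
    f , strictlyIncreasing₄ (toℕ ∘ f) i<j j<k k<l ,
    orderIsomorphicAt p1324 π f (strictlyIncreasing₄ (λ u → toℕ (π ⟨$⟩ʳ f (p1324 ⟨$⟩ˡ u))) a<c c<b b<d)
    where
    f : Fin 4 → Fin n
    f 0F = i
    f 1F = j
    f 2F = k
    f 3F = l

  contains1324⁻ : Contains p1324 π → ¬ Avoids1324 (oneLine π)
  contains1324⁻ (f , inc , iso) av =
    av (tabulate-⊆⁺ _ (f 0F ∷ f 1F ∷ f 2F ∷ f 3F ∷ [])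
         ((inc 0F 1F z<s ∷ inc 0F 2F z<s ∷ inc 0F 3F z<s ∷ [])
          ∷ (inc 1F 2F (s<s z<s) ∷ inc 1F 3F (s<s z<s) ∷ []) ∷ (inc 2F 3F (s<s (s<s z<s)) ∷ []) ∷ [] ∷ []))
       ( Equivalence.to (iso 0F 2F) z<s
       , Equivalence.to (iso 2F 1F) (s<s z<s)
       , Equivalence.to (iso 1F 3F) (s<s (s<s z<s)))

-- Transfer of the count from words to permutations.

patterns : List Pattern
patterns = (4 , p1324) ∷ (3 , p231) ∷ []

AvoidsAll⇒Perm₁₃₂₄ : ∀ {n} (π : Permutation′ n) → AvoidsAll patterns π → Perm₁₃₂₄ n (oneLine π)
AvoidsAll⇒Perm₁₃₂₄ π (av1324 ∷ av231 ∷ []) = record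
  { isPerm = oneLine-Perm π
  ; av231  = λ σ → av231 ∘ contains231⁺ π σ
  ; av1324 = λ σ → av1324 ∘ contains1324⁺ π σ
  }

Perm₁₃₂₄⇒AvoidsAll : ∀ {n} (π : Permutation′ n) → Perm₁₃₂₄ n (oneLine π) → AvoidsAll patterns π
Perm₁₃₂₄⇒AvoidsAll π P = (λ c → contains1324⁻ π c av1324) ∷ (λ c → contains231⁻ π c av231) ∷ []
  where open Perm₁₃₂₄ P

-- The one-line notations of the permutations satisfying `Q` and the listed words with `k`
-- inversions form two lists without repetitions and with the same members, hence of equal length.
length-filter-allPermutations : ∀ {n k} {Q : Pred (Permutation′ n) 0ℓ} (Q? : Decidable Q) →
  (∀ π → Q π → inversions (oneLine π) ≡ k × Perm₁₃₂₄ n (oneLine π)) →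
  (∀ π → inversions (oneLine π) ≡ k → Perm₁₃₂₄ n (oneLine π) → Q π) →
  length (filter Q? (allPermutations n)) ≡ A n k
length-filter-allPermutations {n} {k} {Q} Q? sound complete = begin
  length avoiders                                      ≡⟨ length-map oneLine avoiders ⟨
  length (map oneLine avoiders)                        ≡⟨ ↭-length (∼bag⇒↭ (unique∧set⇒bag unique-avoiders unique-words (mk⇔ to from))) ⟩
  length (filter inversions≟k (words₁₃₂₄ n))           ≡⟨ length-filter-map (_≟ k) inversions (words₁₃₂₄ n) ⟨
  coeff (map inversions (words₁₃₂₄ n)) k               ≡⟨ words₁₃₂₄-coeff n k ⟩
  A n k                                                ∎
  where
  open ≡-Reasoning
  inversions≟k : Decidable (λ w → inversions w ≡ k)
  inversions≟k w = inversions w ≟ k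

  avoiders : List (Permutation′ n)
  avoiders = filter Q? (allPermutations n)

  unique-avoiders : Unique (map oneLine avoiders)
  unique-avoiders = AllPairsₚ.map⁺ (AllPairs.map (λ {π} {ρ} π≉ρ → π≉ρ ∘ oneLine-injective {π = π} {ρ})
    (AllPairsₚ.filter⁺ Q? (allPermutations-unique n)))

  unique-words : Unique (filter inversions≟k (words₁₃₂₄ n))
  unique-words = Uniqueₚ.filter⁺ inversions≟k (words₁₃₂₄-unique n)

  to : ∀ {w} → w ∈ map oneLine avoiders → w ∈ filter inversions≟k (words₁₃₂₄ n)
  to w∈ with π , _ , refl , Qπ ← ∈-map∘filter⁻ oneLine Q? {xs = allPermutations n} w∈
    with inv≡k , P ← sound π Qπ =
    ∈-filter⁺ inversions≟k (words₁₃₂₄-complete n P) inv≡k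

  from : ∀ {w} → w ∈ filter inversions≟k (words₁₃₂₄ n) → w ∈ map oneLine avoiders
  from {w} w∈
    with w∈′ , inv≡k ← ∈-filter⁻ inversions≟k {xs = words₁₃₂₄ n} w∈
    with P ← words₁₃₂₄-sound n w∈′
    with π , π≡w ← oneLine-surjective (Perm₁₃₂₄.isPerm P)
    -- `allPermutations` contains `π` only up to `_≈_`, so the listed representative `ρ`, which has
    -- the same one-line notation, takes its place.
    with ρ , ρ∈ , π≈ρ ← find (allPermutations-complete π) =
    ∈-map∘filter⁺ oneLine Q? {xs = allPermutations n}
      (ρ , ρ∈ , w≡ρ , complete ρ (subst (λ v → inversions v ≡ k) w≡ρ inv≡k) (subst (Perm₁₃₂₄ n) w≡ρ P))
    where
    w≡ρ : w ≡ oneLine ρ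
    w≡ρ = trans (sym π≡w) (tabulate-cong (λ i → cong toℕ (π≈ρ i)))

av-A : ∀ n k → Defs.av n k patterns ≡ A n k
av-A n k = length-filter-allPermutations {n} {k} (λ π → inv π ≟ k ×-dec avoidsAll? patterns π)
  (λ π (inv≡k , avoids) → trans (inversions-oneLine π) inv≡k , AvoidsAll⇒Perm₁₃₂₄ π avoids)
  (λ π inv≡k P → trans (sym (inversions-oneLine π)) inv≡k , Perm₁₃₂₄⇒AvoidsAll π P)

theorem3p2 : InversionMonotone ((4 , p1324) ∷ (3 , p231) ∷ [])
theorem3p2 n k = subst₂ _≤_ (sym (av-A n k)) (sym (av-A (suc n) k)) (A-monotone n k)
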